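{- Let $n=4k+2$ with $k\ge 0$. The maximum number of nonzero entries in an $n\times n$ symmetric alternating sign matrix all of whose main diagonal entries are $0$ equals $\frac{n^2-2n+4}{2}$ (equivalently, the maximum number of edges of an alternating signed graph of order $n$ without loops is $\frac{n^2-2n+4}{4}$). Moreover, an $n\times n$ symmetric ASM with zero main diagonal has exactly $\frac{n^2-2n+4}{2}$ nonzero entries if and only if it equals the hollowed-diamond ASM $D^*_{4k+2}$.
   Context: An alternating sign matrix (ASM) is an $n\times n$ matrix with entries in $\{0,+1,-1\}$ such that in each row and each column the nonzero entries alternate in sign, beginning and ending with $+1$. An alternating signed graph of order $n$ without loops is a graph on vertices $1,\dots,n$ with edges signed $\pm1$ whose signed adjacency matrix is a symmetric ASM with zero main diagonal; its number of edges is half the number of nonzero entries. Let $n=4k+2$, $m=2k+1$, and let $D=[d_{ij}]$ be the $n\times n$ matrix with $d_{ij}=(-1)^{i+j-m-2}$ if $m+2\le i+j\le 3m$ and $|i-j|\le m$, and $d_{ij}=0$ otherwise (the diamond ASM $D_n$). The hollowed-diamond ASM $D^*_{4k+2}$ is obtained from $D$ by setting to $0$ every entry in position $(i,j)$ with $\{i,j\}\subseteq\{k+2t,k+2t+1\}$ for some $t\in\{1,\dots,k\}$. -}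

module Defs where

open import Data.Nat using (ℕ; zero; suc; _+_; _*_; _∸_; _≤ᵇ_; _≡ᵇ_; _/_)
open import Data.Nat.DivMod using (_%_)
open import Data.Bool using (Bool; true; false; _∧_; if_then_else_)
open import Data.Integer using (ℤ; +_; -[1+_])
open import Data.Fin using (Fin; toℕ)
open import Data.List using (List; []; _∷_; tabulate; map; length; upTo; allFin)
open import Data.Nat.ListAction using (sum)
open import Data.Bool.ListAction using (any)
open import Data.Sum using (_⊎_)
open import Relation.Binary.PropositionalEquality using (_≡_)

Matrix : ℕ → Set
Matrix n = Fin n → Fin n → ℤ

nonzeros : List ℤ → List ℤ
nonzeros [] = []
nonzeros (+ zero ∷ xs) = nonzeros xs
nonzeros (+ suc m ∷ xs) = + suc m ∷ nonzeros xs
nonzeros (-[1+ m ] ∷ xs) = -[1+ m ] ∷ nonzeros xs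

data Alternating : List ℤ → Set where
  alt-one  : Alternating (+ 1 ∷ [])
  alt-step : ∀ {xs} → Alternating xs → Alternating (+ 1 ∷ -[1+ 0 ] ∷ xs)

row : ∀ {n} → Matrix n → Fin n → List ℤ
row M i = tabulate (M i)

col : ∀ {n} → Matrix n → Fin n → List ℤ
col M j = tabulate (λ i → M i j)

IsSignEntry : ℤ → Set
IsSignEntry x = (x ≡ + 0) ⊎ ((x ≡ + 1) ⊎ (x ≡ -[1+ 0 ]))

record IsASM {n : ℕ} (M : Matrix n) : Set where
  field
    entries : ∀ i j → IsSignEntry (M i j)
    rows    : ∀ i → Alternating (nonzeros (row M i))
    cols    : ∀ j → Alternating (nonzeros (col M j))

IsSymmetric : ∀ {n} → Matrix n → Set
IsSymmetric M = ∀ i j → M i j ≡ M j i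

ZeroDiagonal : ∀ {n} → Matrix n → Set
ZeroDiagonal M = ∀ i → M i i ≡ + 0

-- symmetric ASM with zero main diagonal (= signed adjacency matrix of a loopless alternating signed graph)
record IsSymASM0 {n : ℕ} (M : Matrix n) : Set where
  field
    asm  : IsASM M
    sym  : IsSymmetric M
    diag : ZeroDiagonal M

nnz : ∀ {n} → Matrix n → ℕ
nnz {n} M = sum (map (λ i → length (nonzeros (row M i))) (allFin n))

signPow : ℕ → ℤ
signPow e = if (e % 2 ≡ᵇ 0) then + 1 else -[1+ 0 ]

-- Diamond ASM D_n with m = 2k+1, n = 4k+2, using 1-based indices i, j
-- d_ij = (-1)^(i+j-m-2) if m+2 ≤ i+j ≤ 3m and |i-j| ≤ m, else 0
diamondEntry : ℕ → ℕ → ℕ → ℤ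
diamondEntry m i j =
  if ((m + 2) ≤ᵇ (i + j)) ∧ ((i + j) ≤ᵇ (3 * m)) ∧ ((i ∸ j) ≤ᵇ m) ∧ ((j ∸ i) ≤ᵇ m)
  then signPow (i + j ∸ (m + 2))
  else + 0

inPair : ℕ → ℕ → ℕ → Bool
inPair k t x = (x ≡ᵇ (k + 2 * t)) Data.Bool.∨ (x ≡ᵇ (k + 2 * t + 1))

hollowed : ℕ → ℕ → ℕ → Bool
hollowed k i j = any (λ t → inPair k t i ∧ inPair k t j) (map suc (upTo k))

hollowedDiamond : (k : ℕ) → Matrix (4 * k + 2)
hollowedDiamond k i j =
  let i' = suc (toℕ i) ; j' = suc (toℕ j) in
  if hollowed k i' j' then + 0 else diamondEntry (2 * k + 1) i' j'

bound : ℕ → ℕ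
bound n = (n * n + 4 ∸ 2 * n) / 2

{-# OPTIONS --safe #-}
module Submission where

-- Describe M by its partial column sums c i j ∈ {0, 1} (column j, first i rows); by symmetry these
-- are also its partial row sums, and each entry is a six-vertex configuration. Row i (counted from
-- 0) has 2i + 1 - 2s nonzero entries, where s is the number of 1s of c i that survive in c (i + 1).
-- The bottom half of M is the top half of the matrix rotated by 180°, so everything reduces to the
-- claim that at least k ones survive in the top m = 2k + 1 rows.
--
-- Every 1 on the diagonal of c survives, the diagonal of M being 0, and it forces a second survivor
-- next to the diagonal, since a row cannot create two adjacent 1s. If on the other hand there are
-- few 1s on the diagonal, then few of the m ones of c m lie in its left half (twice as many as on
-- the diagonal), and the right half is so crowded that many 1s survive the middle row. The sum of
-- the two estimates is exactly what is needed.
--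
-- In case of equality every survivor is accounted for. This determines the middle row of partial
-- sums, and then the rows above it one by one: symmetry provides the partial row sums between the
-- diagonal and the middle, and elsewhere they are forced by the pattern 1010…1 of the row below.

open import Defs
open import Data.Bool using (Bool; true; false; not; _∧_; _∨_; _xor_; if_then_else_; T)
open import Data.Bool.ListAction using (any)
import Data.Bool.Properties as Bool
open import Data.Bool.Properties using (not-involutive; ∨-zeroʳ; ∧-comm; T-≡; T-∧; T-∨)
open import Data.Fin using (Fin; toℕ; fromℕ<)
open import Data.Fin.Properties using (toℕ-fromℕ<; toℕ<n)
open import Data.Integer using (ℤ; -[1+_]) renaming (+_ to pos)
open import Data.List using (List; []; _∷_; tabulate; map; length; upTo)
open import Data.List.Properties using (map-tabulate)
import Data.List.Relation.Unary.Any.Properties as Any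
open import Data.Nat using (ℕ; zero; suc; _+_; _*_; _∸_; _/_; _≤_; _<_; z≤n; s≤s; s≤s⁻¹; _≤ᵇ_; _≡ᵇ_)
open import Data.Nat.DivMod using (m*n/n≡m)
open import Data.Nat.ListAction using (sum)
open import Data.Nat.Properties
open import Data.Nat.Tactic.RingSolver using (solve)
open import Data.Product using (_×_; _,_; proj₁; proj₂; ∃-syntax)
open import Data.Sum using (_⊎_; inj₁; inj₂; [_,_]′)
open import Function using (_∘_; id)
open import Function.Bundles using (_⇔_; mk⇔; Equivalence)
open import Relation.Binary.Definitions using (tri<; tri≈; tri>)
open import Relation.Binary.PropositionalEquality
open import Relation.Nullary using (¬_; Dec; yes; no; does; contradiction)
open import Relation.Nullary.Decidable using (_×-dec_; _⊎-dec_; dec-true; dec-false)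

-- Inequalities and sums

-- The one shape in which linear inequalities are derived: a linear combination A ≤ B of the
-- hypotheses and a slack s with X + s - Y = A - B; the equation is then left to the ring solver.
linear : ∀ {A B X Y} s → A ≤ B → X + s + B ≡ Y + A → X ≤ Y
linear {A} {B} {X} {Y} s A≤B eq = m+n≤o⇒m≤o X (+-cancelʳ-≤ B (X + s) Y
  (≤-trans (≤-reflexive eq) (+-monoʳ-≤ Y A≤B)))

impossible : ∀ {ℓ} {W : Set ℓ} {A B} s → A ≤ B → 1 + s + B ≡ A → W
impossible {A = A} {B} s A≤B eq = contradiction (≤-trans (m≤n+m (suc B) s) (≤-trans (≤-reflexive
  (trans (+-suc s B) eq)) A≤B)) (<-irrefl refl)

halve-≤ : ∀ {a b} → a + a ≤ suc (b + b) → a ≤ b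
halve-≤ {a} {b} p with a ≤? b
... | yes q = q
... | no ¬q = impossible 0 (+-mono-≤ p (+-mono-≤ (≰⇒> ¬q) (≰⇒> ¬q))) (eq a b)
  where
  eq : ∀ a b → 1 + 0 + (suc (b + b) + (a + a)) ≡ a + a + (suc b + suc b)
  eq a b = solve (a ∷ b ∷ [])

∑ : ℕ → (ℕ → ℕ) → ℕ
∑ zero    f = 0
∑ (suc n) f = ∑ n f + f n

∑-cong : ∀ n {f g} → (∀ j → j < n → f j ≡ g j) → ∑ n f ≡ ∑ n g
∑-cong zero    eq = refl
∑-cong (suc n) eq = cong₂ _+_ (∑-cong n λ j j<n → eq j (m<n⇒m<1+n j<n)) (eq n (n<1+n n))

∑-mono : ∀ n {f g} → (∀ j → j < n → f j ≤ g j) → ∑ n f ≤ ∑ n g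
∑-mono zero    le = z≤n
∑-mono (suc n) le = +-mono-≤ (∑-mono n λ j j<n → le j (m<n⇒m<1+n j<n)) (le n (n<1+n n))

∑-add : ∀ n f g → ∑ n (λ j → f j + g j) ≡ ∑ n f + ∑ n g
∑-add zero    f g = refl
∑-add (suc n) f g = trans (cong (_+ (f n + g n)) (∑-add n f g)) (interchange (∑ n f) (∑ n g) (f n) (g n))
  where
  interchange : ∀ a b c d → (a + b) + (c + d) ≡ (a + c) + (b + d)
  interchange a b c d = solve (a ∷ b ∷ c ∷ d ∷ [])

∑-const : ∀ n a → ∑ n (λ _ → a) ≡ n * a
∑-const zero    a = refl
∑-const (suc n) a = trans (cong (_+ a) (∑-const n a)) (+-comm (n * a) a)

∑-split : ∀ a b f → ∑ (a + b) f ≡ ∑ a f + ∑ b (λ j → f (a + j))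
∑-split a zero    f = trans (cong (λ l → ∑ l f) (+-identityʳ a)) (sym (+-identityʳ _))
∑-split a (suc b) f = begin
  ∑ (a + suc b) f                                    ≡⟨ cong (λ l → ∑ l f) (+-suc a b) ⟩
  ∑ (a + b) f + f (a + b)                            ≡⟨ cong (_+ f (a + b)) (∑-split a b f) ⟩
  ∑ a f + ∑ b (λ j → f (a + j)) + f (a + b)          ≡⟨ +-assoc (∑ a f) _ _ ⟩
  ∑ a f + ∑ (suc b) (λ j → f (a + j))                ∎
  where open ≡-Reasoning

∑-head : ∀ n f → ∑ (suc n) f ≡ f 0 + ∑ n (f ∘ suc)
∑-head n f = ∑-split 1 n f

∑-reverse : ∀ n f → ∑ n f ≡ ∑ n (λ j → f (n ∸ suc j))
∑-reverse zero    f = refl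
∑-reverse (suc n) f = begin
  ∑ n f + f n                             ≡⟨ cong (_+ f n) (∑-reverse n f) ⟩
  ∑ n (λ j → f (n ∸ suc j)) + f n         ≡⟨ +-comm _ (f n) ⟩
  f n + ∑ n (λ j → f (n ∸ suc j))         ≡⟨ ∑-head n (λ j → f (n ∸ j)) ⟨
  ∑ (suc n) (λ j → f (suc n ∸ suc j))     ∎
  where open ≡-Reasoning

∑-zero : ∀ n f → ∑ n f ≡ 0 → ∀ j → j < n → f j ≡ 0
∑-zero (suc n) f eq j (s≤s j≤n) with m≤n⇒m<n∨m≡n j≤n
... | inj₁ j<n  = ∑-zero n f (m+n≡0⇒m≡0 (∑ n f) eq) j j<n
... | inj₂ refl = m+n≡0⇒n≡0 (∑ n f) eq

∑-all-zero : ∀ n f → (∀ j → j < n → f j ≡ 0) → ∑ n f ≡ 0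
∑-all-zero n f eq = trans (∑-cong n eq) (trans (∑-const n 0) (*-zeroʳ n))

∑-single : ∀ n f a b → f a ≤ b → (∀ j → j < n → j ≢ a → f j ≡ 0) → ∑ n f ≤ b
∑-single zero    f a b fa≤b off = z≤n
∑-single (suc n) f a b fa≤b off with n ≟ a
... | yes refl = ≤-trans (≤-reflexive (cong (_+ f n) (∑-all-zero n f
                   λ j j<n → off j (m<n⇒m<1+n j<n) (<⇒≢ j<n)))) fa≤b
... | no  n≢a  = ≤-trans (≤-reflexive (trans (cong (∑ n f +_) (off n (n<1+n n) n≢a)) (+-identityʳ _)))
                   (∑-single n f a b fa≤b λ j j<n → off j (m<n⇒m<1+n j<n))

-- Telescoping without subtraction, the boundary terms standing on opposite sides. In the uses `p`
-- is the sequence of partial sums along a row.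
∑-telescope : ∀ n (f g p : ℕ → ℕ) → (∀ j → j < n → f j + p j ≡ g j + p (suc j)) → ∑ n f + p 0 ≡ ∑ n g + p n
∑-telescope zero    f g p eq = refl
∑-telescope (suc n) f g p eq = begin
  ∑ n f + f n + p 0        ≡⟨ xy∙z≈xz∙y (∑ n f) (f n) (p 0) ⟩
  ∑ n f + p 0 + f n        ≡⟨ cong (_+ f n) (∑-telescope n f g p λ j j<n → eq j (m<n⇒m<1+n j<n)) ⟩
  ∑ n g + p n + f n        ≡⟨ +-assoc (∑ n g) _ _ ⟩
  ∑ n g + (p n + f n)      ≡⟨ cong (∑ n g +_) (+-comm (p n) (f n)) ⟩
  ∑ n g + (f n + p n)      ≡⟨ cong (∑ n g +_) (eq n (n<1+n n)) ⟩
  ∑ n g + (g n + p (suc n)) ≡⟨ +-assoc (∑ n g) _ _ ⟨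
  ∑ n g + g n + p (suc n)  ∎
  where
  open ≡-Reasoning
  xy∙z≈xz∙y : ∀ a b c → a + b + c ≡ a + c + b
  xy∙z≈xz∙y a b c = solve (a ∷ b ∷ c ∷ [])

-- In row `1 + a` the four middle terms are the columns from one left of the diagonal to two right
-- of it, the only places whose survivors are charged to diagonal 1s.
∑-window : ∀ a b f → ∑ (a + (4 + b)) f ≡
  ∑ a f + (f a + f (1 + a) + f (2 + a) + f (3 + a)) + ∑ b (λ j → f (4 + a + j))
∑-window a b f = begin
  ∑ (a + (4 + b)) f  ≡⟨ cong (λ l → ∑ l f) (trans (sym (+-assoc a 4 b)) (cong (_+ b) (+-comm a 4))) ⟩
  ∑ (4 + a + b) f    ≡⟨ ∑-split (4 + a) b f ⟩
  ∑ a f + f a + f (1 + a) + f (2 + a) + f (3 + a) + rest ≡⟨ assoc (∑ a f) (f a) (f (1 + a)) (f (2 + a)) (f (3 + a)) rest ⟩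
  ∑ a f + (f a + f (1 + a) + f (2 + a) + f (3 + a)) + rest ∎
  where
  open ≡-Reasoning
  rest : ℕ
  rest = ∑ b (λ j → f (4 + a + j))
  assoc : ∀ s p q t u v → s + p + q + t + u + v ≡ s + (p + q + t + u) + v
  assoc s p q t u v = solve (s ∷ p ∷ q ∷ t ∷ u ∷ v ∷ [])

-- Partial sums of symmetric ASMs

ι : Bool → ℕ
ι false = 0
ι true  = 1

-- The entries 0, +1, -1 of an ASM, seen through the partial column sums above and below the entry
-- and the partial row sums to its left and right (a six-vertex configuration).
data Vertex : (x y h h′ : Bool) → Set where
  stay  : ∀ {x h} → Vertex x x h h
  plus  : Vertex false true false true
  minus : Vertex true false true false

-- c i j is the sum of the first i entries of column j. By symmetry c j i is then the sum of the
-- first j entries of row i.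
record Path (n : ℕ) (c : ℕ → ℕ → Bool) : Set where
  field
    top    : ∀ {j} → j < n → c 0 j ≡ false
    bottom : ∀ {j} → j < n → c n j ≡ true
    vertex : ∀ {i j} → i < n → j < n → Vertex (c i j) (c (suc i) j) (c j i) (c (suc j) i)
    diag   : ∀ {i} → i < n → c (suc i) i ≡ c i i

both neither change : (ℕ → ℕ → Bool) → ℕ → ℕ → ℕ
both    c i j = ι (c i j ∧ c (suc i) j)
neither c i j = ι (not (c i j) ∧ not (c (suc i) j))
change  c i j = ι (c i j xor c (suc i) j)

bit : (ℕ → ℕ → Bool) → ℕ → ℕ → ℕ
bit c i j = ι (c i j)

onDiag : (ℕ → ℕ → Bool) → ℕ → ℕ
onDiag c i = bit c i i

-- Every 1 of the partial sums that survives a row in the top half costs two nonzero entries.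
loss : ℕ → ℕ → (ℕ → ℕ → Bool) → ℕ
loss m n c = ∑ m λ i → ∑ n (both c i)

ι-injective : ∀ {a b} → ι a ≡ ι b → a ≡ b
ι-injective {false} {false} _ = refl
ι-injective {true}  {true}  _ = refl

ι≤1 : ∀ b → ι b ≤ 1
ι≤1 false = z≤n
ι≤1 true  = ≤-refl

-- A row cannot create two adjacent 1s, as its nonzero entries alternate.
adjacent-vertices : ∀ {x y h x′ y′ h′ h″} → Vertex x y h h′ → Vertex x′ y′ h′ h″ →
  y ≡ true → y′ ≡ true → 1 ≤ ι (x ∧ y) + ι (x′ ∧ y′)
adjacent-vertices stay v refl refl = s≤s z≤n
adjacent-vertices plus stay refl refl = ≤-refl

falling : ∀ {x y h h′} → Vertex x y h h′ → h ≡ true → h′ ≡ false → x ≡ true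
falling stay  refl ()
falling minus refl refl = refl

module _ {n c} (P : Path n c) where
  open Path P

  both-diag : ∀ {i} → i < n → both c i i ≡ onDiag c i
  both-diag {i} i<n with c i i | c (suc i) i | diag i<n
  ... | false | _ | refl = refl
  ... | true  | _ | refl = refl

  both-top : ∀ {j} → j < n → both c 0 j ≡ 0
  both-top {j} j<n rewrite top j<n = refl

  -- The entries of row `i` in a window of `l` columns are added up in two ways: as increments of
  -- the column sums and, by symmetry, as the increment of the partial row sum.
  flux : ∀ {i} → i < n → ∀ a l → a + l ≤ n →
    ∑ l (λ j → bit c (suc i) (a + j)) + bit c a i ≡ ∑ l (λ j → bit c i (a + j)) + bit c (a + l) i
  flux {i} i<n a l a+l≤n = subst (λ z → ∑ l (λ j → bit c (suc i) (a + j)) + bit c z i ≡ ∑ l (λ j → bit c i (a + j)) + bit c (a + l) i)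
    (+-identityʳ a) (∑-telescope l (λ j → bit c (suc i) (a + j)) (λ j → bit c i (a + j)) (λ j → bit c (a + j) i) local)
    where
    local : ∀ j → j < l → bit c (suc i) (a + j) + bit c (a + j) i ≡ bit c i (a + j) + bit c (a + suc j) i
    local j j<l rewrite +-suc a j with c i (a + j) | c (suc i) (a + j) | c (a + j) i | c (suc (a + j)) i
      | vertex i<n (≤-trans (+-monoʳ-< a j<l) a+l≤n)
    ... | _ | _ | _ | _ | stay  = refl
    ... | _ | _ | _ | _ | plus  = refl
    ... | _ | _ | _ | _ | minus = refl

  -- Each cell satisfies `both` + 1 = `neither` + x + y, with x the column sum above it and y the
  -- one below, and x is y minus the entry. The entries telescope along the row.
  defect : ∀ {i} → i < n → ∀ a l → a + l ≤ n → let y = ∑ l (λ j → bit c (suc i) (a + j)) in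
    ∑ l (λ j → both c i (a + j)) + l + bit c (a + l) i ≡ ∑ l (λ j → neither c i (a + j)) + (y + y) + bit c a i
  defect {i} i<n a l a+l≤n = begin
    ∑ l B + l + bit c (a + l) i
      ≡⟨ cong (λ z → ∑ l B + z + bit c (a + l) i) (trans (∑-const l 1) (*-identityʳ l)) ⟨
    ∑ l B + ∑ l (λ _ → 1) + bit c (a + l) i
      ≡⟨ cong (_+ bit c (a + l) i) (∑-add l B (λ _ → 1)) ⟨
    ∑ l (λ j → B j + 1) + bit c (a + l) i
      ≡⟨ ∑-telescope l (λ j → N j + (Y j + Y j)) (λ j → B j + 1) (λ j → bit c (a + j) i) local ⟨
    ∑ l (λ j → N j + (Y j + Y j)) + bit c (a + 0) i
      ≡⟨ cong₂ (λ z w → z + bit c w i) (trans (∑-add l N (λ j → Y j + Y j)) (cong (∑ l N +_) (∑-add l Y Y))) (+-identityʳ a) ⟩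
    ∑ l N + (∑ l Y + ∑ l Y) + bit c a i ∎
    where
    open ≡-Reasoning
    B N Y : ℕ → ℕ
    B j = both c i (a + j)
    N j = neither c i (a + j)
    Y j = bit c (suc i) (a + j)
    local : ∀ j → j < l → N j + (Y j + Y j) + bit c (a + j) i ≡ B j + 1 + bit c (a + suc j) i
    local j j<l rewrite +-suc a j with c i (a + j) | c (suc i) (a + j) | c (a + j) i | c (suc (a + j)) i
      | vertex i<n (≤-trans (+-monoʳ-< a j<l) a+l≤n)
    ... | false | _ | false | _ | stay  = refl
    ... | false | _ | true  | _ | stay  = refl
    ... | true  | _ | false | _ | stay  = refl
    ... | true  | _ | true  | _ | stay  = refl
    ... | _ | _ | _ | _ | plus  = refl
    ... | _ | _ | _ | _ | minus = refl

  row-total : ∀ i → i ≤ n → ∑ n (bit c i) ≡ i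
  row-total zero    _   = ∑-all-zero n (bit c 0) λ j j<n → cong ι (top j<n)
  row-total (suc i) i<n = begin
    ∑ n (bit c (suc i))              ≡⟨ +-identityʳ _ ⟨
    ∑ n (bit c (suc i)) + 0          ≡⟨ cong (λ b → ∑ n (bit c (suc i)) + ι b) (top i<n) ⟨
    ∑ n (bit c (suc i)) + bit c 0 i  ≡⟨ flux i<n 0 n ≤-refl ⟩
    ∑ n (bit c i) + bit c n i        ≡⟨ cong₂ (λ s b → s + ι b) (row-total i (<⇒≤ i<n)) (bottom i<n) ⟩
    i + 1                            ≡⟨ +-comm i 1 ⟩
    suc i                            ∎
    where open ≡-Reasoning

  -- Every diagonal 1 counts twice: by symmetry the first `i` entries of row `i` add up to `c i i`,
  -- and the new column `i` contributes `c (suc i) i`, which is the same as the diagonal entry is 0.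
  corner-total : ∀ i → i ≤ n → ∑ i (bit c i) ≡ ∑ i (onDiag c) + ∑ i (onDiag c)
  corner-total zero    _   = refl
  corner-total (suc i) i<n = begin
    ∑ i (bit c (suc i)) + bit c (suc i) i               ≡⟨ cong₂ _+_ below (cong ι (diag i<n)) ⟩
    ∑ i (bit c i) + p + p                               ≡⟨ cong (λ s → s + p + p) (corner-total i (<⇒≤ i<n)) ⟩
    s + s + p + p                                       ≡⟨ rearrange s p ⟩
    (s + p) + (s + p)                                   ∎
    where
    open ≡-Reasoning
    p s : ℕ
    p = onDiag c i
    s = ∑ i (onDiag c)
    rearrange : ∀ s p → s + s + p + p ≡ (s + p) + (s + p)
    rearrange s p = solve (s ∷ p ∷ [])
    below : ∑ i (bit c (suc i)) ≡ ∑ i (bit c i) + p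
    below = begin
      ∑ i (bit c (suc i))              ≡⟨ +-identityʳ _ ⟨
      ∑ i (bit c (suc i)) + 0          ≡⟨ cong (λ b → ∑ i (bit c (suc i)) + ι b) (top i<n) ⟨
      ∑ i (bit c (suc i)) + bit c 0 i  ≡⟨ flux i<n 0 i (<⇒≤ i<n) ⟩
      ∑ i (bit c i) + p                ∎

  change-total : ∀ {i} → i < n → ∑ n (change c i) + (∑ n (both c i) + ∑ n (both c i)) ≡ i + suc i
  change-total {i} i<n = begin
    ∑ n (change c i) + (∑ n B + ∑ n B)           ≡⟨ cong (∑ n (change c i) +_) (∑-add n B B) ⟨
    ∑ n (change c i) + ∑ n (λ j → B j + B j)     ≡⟨ ∑-add n (change c i) (λ j → B j + B j) ⟨
    ∑ n (λ j → change c i j + (B j + B j))       ≡⟨ ∑-cong n (λ j _ → local (c i j) (c (suc i) j)) ⟩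
    ∑ n (λ j → bit c i j + bit c (suc i) j)      ≡⟨ ∑-add n (bit c i) (bit c (suc i)) ⟩
    ∑ n (bit c i) + ∑ n (bit c (suc i))          ≡⟨ cong₂ _+_ (row-total i (<⇒≤ i<n)) (row-total (suc i) i<n) ⟩
    i + suc i                                    ∎
    where
    open ≡-Reasoning
    B : ℕ → ℕ
    B = both c i
    local : ∀ x y → ι (x xor y) + (ι (x ∧ y) + ι (x ∧ y)) ≡ ι x + ι y
    local false false = refl
    local false true  = refl
    local true  false = refl
    local true  true  = refl

  -- The odd numbers `i + suc i` of `change-total` add up to a square, from which each survivor
  -- takes away two.
  changes-above : ∀ m → m ≤ n → ∑ m (λ i → ∑ n (change c i)) + (loss m n c + loss m n c) ≡ m * m
  changes-above zero    _   = refl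
  changes-above (suc m) m<n = begin
    C + c′ + ((L + l) + (L + l))    ≡⟨ rearrange C c′ L l ⟩
    (C + (L + L)) + (c′ + (l + l))  ≡⟨ cong₂ _+_ (changes-above m (<⇒≤ m<n)) (change-total m<n) ⟩
    m * m + (m + suc m)             ≡⟨ solve (m ∷ []) ⟩
    suc m * suc m                   ∎
    where
    open ≡-Reasoning
    C c′ L l : ℕ
    C = ∑ m (λ i → ∑ n (change c i))
    c′ = ∑ n (change c m)
    L = loss m n c
    l = ∑ n (both c m)
    rearrange : ∀ C c L l → C + c + ((L + l) + (L + l)) ≡ (C + (L + L)) + (c + (l + l))
    rearrange C c L l = solve (C ∷ c ∷ L ∷ l ∷ [])

  adjacent : ∀ {i j} → i < n → suc j < n → c (suc i) j ≡ true → c (suc i) (suc j) ≡ true →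
    1 ≤ both c i j + both c i (suc j)
  adjacent i<n sj<n = adjacent-vertices (vertex i<n (<⇒≤ sj<n)) (vertex i<n sj<n)

  -- If the diagonal 1 does not outlive the row after next, the entry there is -1. So is its mirror
  -- image, which needs a 1 above it, adjacent to the diagonal 1; two adjacent 1s cannot both be
  -- new.
  diag⇒survivors : ∀ {i} → suc (suc i) < n → c (suc i) (suc i) ≡ true →
    1 ≤ both c (suc (suc i)) (suc i) + (both c i (suc i) + both c i (suc (suc i)))
  diag⇒survivors {i} ssi<n p
    with c (suc (suc (suc i))) (suc i) in eq | trans (diag (<⇒≤ ssi<n)) p
  ... | true  | q rewrite q = s≤s z≤n
  ... | false | q = m≤n⇒m≤o+n (ι (c (suc (suc i)) (suc i) ∧ false))
    (adjacent (<-trans (n<1+n i) (<⇒≤ ssi<n)) ssi<n p (falling (vertex (<⇒≤ ssi<n) ssi<n) q eq))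

-- The number of surviving 1s

-- `subDiag` is indexed by the row of its cell, `superDiag` by the row below its two cells, that is,
-- by the diagonal 1 to which they are charged. At 0 these cells would lie outside the matrix.
subDiag superDiag : (ℕ → ℕ → Bool) → ℕ → ℕ
subDiag c zero    = 0
subDiag c (suc i) = both c (suc i) i
superDiag c zero    = 0
superDiag c (suc i) = both c i (suc i) + both c i (suc (suc i))

-- Parity: twice `u` falls short of twice `k` by at most 1, hence not at all.
halve : ∀ {k u p a b s} → p ≤ 1 → u + u + p ≡ a + b + (k + k) + s → k ≤ u
halve {k} {u} {p} {a} {b} {s} p≤1 eq with k ≤? u
... | yes k≤u = k≤u
... | no  k≰u = impossible (a + b + s) (+-mono-≤ (+-mono-≤ (≰⇒> k≰u) (≰⇒> k≰u)) p≤1)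
  (trans (lhs k a b s) (trans (cong (2 +_) (sym eq)) (rhs u p)))
  where
  lhs : ∀ k a b s → 1 + (a + b + s) + (k + k + 1) ≡ 2 + (a + b + (k + k) + s)
  lhs k a b s = solve (k ∷ a ∷ b ∷ s ∷ [])
  rhs : ∀ u p → 2 + (u + u + p) ≡ suc u + suc u + p
  rhs u p = solve (u ∷ p ∷ [])

slack≡0 : ∀ {p a s} → p ≤ 1 → p ≡ a + (s + s) → s ≡ 0
slack≡0 {s = zero}  _   _  = refl
slack≡0 {a = a} {s = suc s} p≤1 refl = impossible (a + (s + s)) p≤1 (solve (a ∷ s ∷ []))

module Budget {r c} (P : Path (suc r + suc r) c) where
  open Path P

  private
    m n : ℕ
    m = suc r
    n = m + m

    alive : ℕ → ℕ
    alive i = ∑ n (both c i)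

    m≤n : m ≤ n
    m≤n = m≤m+n m m

  -- Row `r` is the last one of the top half; `A` and `p` count the diagonal 1s before and in it.
  -- `R11` and `R00` count the cells of its right half where a 1 or a 0 persists.
  A p U R11 R00 σ : ℕ
  A = ∑ r (onDiag c)
  p = onDiag c r
  U = loss m n c
  R11 = ∑ m (λ j → both c r (m + j))
  R00 = ∑ m (λ j → neither c r (m + j))

  -- A 1 on the diagonal in row i survives that row, and with it a 1 at (i + 1, i), (i - 1, i) or
  -- (i - 1, i + 1). These cells differ for different i; σ collects all that is lost beyond them.
  excess : ℕ → ℕ
  excess i = superDiag c i + subDiag c (suc i) ∸ onDiag c i

  remote : ℕ → ℕ
  remote i = ∑ (i ∸ 1) (both c i) + ∑ (n ∸ (3 + i)) (λ j → both c i (3 + i + j))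

  -- The last row is special: the cell below its diagonal cell lies outside the top half, so
  -- `superDiag c r` is surplus as a whole, and its right half is counted by `R11`.
  σ = ∑ r excess + superDiag c r + ∑ r remote + ∑ (r ∸ 1) (both c r)

  row-split : ∀ i → i < r → alive i ≡ subDiag c i + onDiag c i + superDiag c (suc i) + remote i
  -- Row 0 has no survivors, so both sides vanish; the window used for the other rows would begin
  -- left of the matrix.
  row-split zero    0<r = begin
    ∑ n (both c 0)
      ≡⟨ ∑-all-zero n (both c 0) (λ j → both-top P) ⟩
    0
      ≡⟨ cong₂ _+_ (cong ι (top z<n)) (cong₂ _+_ (both-top P (<-trans (n<1+n 1) 2<n)) (both-top P 2<n)) ⟨
    onDiag c 0 + superDiag c 1
      ≡⟨ +-identityʳ _ ⟨
    onDiag c 0 + superDiag c 1 + 0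
      ≡⟨ cong (onDiag c 0 + superDiag c 1 +_) (∑-all-zero (n ∸ 3) (λ j → both c 0 (3 + j))
           (λ j j<n∸3 → both-top P (≤-trans (+-monoʳ-≤ 3 j<n∸3) (≤-reflexive (m+[n∸m]≡n 2<n))))) ⟨
    onDiag c 0 + superDiag c 1 + remote 0 ∎
    where
    open ≡-Reasoning
    z<n : 0 < n
    z<n = s≤s z≤n
    2<n : 2 < n
    2<n = s≤s (≤-trans (s≤s 0<r) (m≤n+m m r))
  row-split (suc i) i<r = begin
    ∑ n (both c (suc i))
      ≡⟨ cong (λ l → ∑ l (both c (suc i))) n-split ⟨
    ∑ (i + (4 + (n ∸ (4 + i)))) (both c (suc i))
      ≡⟨ ∑-window i (n ∸ (4 + i)) (both c (suc i)) ⟩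
    before + (t₀ + t₁ + t₂ + t₃) + after
      ≡⟨ cong (λ t → before + (t₀ + t + t₂ + t₃) + after) (both-diag P (≤-trans i<r (≤-trans (n≤1+n r) m≤n))) ⟩
    before + (t₀ + onDiag c (suc i) + t₂ + t₃) + after
      ≡⟨ rearrange before t₀ (onDiag c (suc i)) t₂ t₃ after ⟩
    t₀ + onDiag c (suc i) + (t₂ + t₃) + (before + after) ∎
    where
    open ≡-Reasoning
    t₀ t₁ t₂ t₃ before after : ℕ
    t₀ = both c (suc i) i
    t₁ = both c (suc i) (1 + i)
    t₂ = both c (suc i) (2 + i)
    t₃ = both c (suc i) (3 + i)
    before = ∑ i (both c (suc i))
    after  = ∑ (n ∸ (4 + i)) (λ j → both c (suc i) (4 + i + j))
    rearrange : ∀ b s p t u a → b + (s + p + t + u) + a ≡ s + p + (t + u) + (b + a)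
    rearrange b s p t u a = solve (b ∷ s ∷ p ∷ t ∷ u ∷ a ∷ [])
    n-split : i + (4 + (n ∸ (4 + i))) ≡ n
    n-split = trans (sym (+-assoc i 4 _)) (trans (cong (_+ (n ∸ (4 + i))) (+-comm i 4))
      (m+[n∸m]≡n 4+i≤n))
      where
      4+i≤n : 4 + i ≤ n
      4+i≤n = linear r i<r (eq i r)
        where
        eq : ∀ i r → 4 + i + r + r ≡ suc r + suc r + suc (suc i)
        eq i r = solve (i ∷ r ∷ [])

  last-row : alive r ≡ ∑ (r ∸ 1) (both c r) + subDiag c r + p + R11
  last-row = trans (∑-split m m (both c r)) (cong (_+ R11) (cong₂ _+_ (initial r) (both-diag P m≤n)))
    where
    initial : ∀ r → ∑ r (both c r) ≡ ∑ (r ∸ 1) (both c r) + subDiag c r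
    initial zero    = refl
    initial (suc r) = refl

  neighbour : ∀ i → i < r → superDiag c i + subDiag c (suc i) ≡ onDiag c i + excess i
  neighbour zero    i<r rewrite top {0} (s≤s z≤n) = refl
  neighbour (suc i) i<r = sym (m+[n∸m]≡n enough)
    where
    enough : onDiag c (suc i) ≤ superDiag c (suc i) + subDiag c (suc (suc i))
    enough with c (suc i) (suc i) in eq
    ... | false = z≤n
    ... | true  = ≤-trans (diag⇒survivors P (≤-trans (s≤s i<r) m≤n) eq)
      (≤-reflexive (trans (+-comm (both c (suc (suc i)) (suc i)) _)
        (cong (λ b → ι (c i (suc i) ∧ b) + both c i (suc (suc i)) + both c (suc (suc i)) (suc i)) eq)))

  -- Survivors are regrouped by the diagonal 1 to which they are charged: each of the first `r` rows
  -- pays for its diagonal 1 twice, the last row only once.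
  budget : U ≡ A + A + p + R11 + σ
  budget = begin
    ∑ r alive + alive r
      ≡⟨ cong₂ _+_ rows last-row ⟩
    ∑ r sub + A + ∑ r (super ∘ suc) + X + (x + sub r + p + R11)
      ≡⟨ rearrange₁ (∑ r sub) A (∑ r (super ∘ suc)) X x (sub r) p R11 ⟩
    (∑ r sub + sub r) + ∑ r (super ∘ suc) + A + p + R11 + X + x
      -- Both sequences vanish at 0, so `∑-head` shifts the charge by one row without a boundary
      -- term.
      ≡⟨ cong₂ (λ s t → s + t + A + p + R11 + X + x) (∑-head r sub) (sym (∑-head r super)) ⟩
    ∑ r (sub ∘ suc) + (∑ r super + super r) + A + p + R11 + X + x
      ≡⟨ rearrange₂ (∑ r (sub ∘ suc)) (∑ r super) (super r) A p R11 X x ⟩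
    (∑ r super + ∑ r (sub ∘ suc)) + A + p + R11 + (super r + X + x)
      ≡⟨ cong (λ s → s + A + p + R11 + (super r + X + x)) neighbours ⟩
    A + ∑ r excess + A + p + R11 + (super r + X + x)
      ≡⟨ rearrange₃ A (∑ r excess) p R11 (super r) X x ⟩
    A + A + p + R11 + σ ∎
    where
    open ≡-Reasoning
    sub super : ℕ → ℕ
    sub = subDiag c
    super = superDiag c
    X x : ℕ
    X = ∑ r remote
    x = ∑ (r ∸ 1) (both c r)
    rows : ∑ r alive ≡ ∑ r sub + A + ∑ r (super ∘ suc) + X
    rows = begin
      ∑ r alive
        ≡⟨ ∑-cong r row-split ⟩
      ∑ r (λ i → sub i + onDiag c i + super (suc i) + remote i)
        ≡⟨ ∑-add r (λ i → sub i + onDiag c i + super (suc i)) remote ⟩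
      ∑ r (λ i → sub i + onDiag c i + super (suc i)) + X
        ≡⟨ cong (_+ X) (∑-add r (λ i → sub i + onDiag c i) (super ∘ suc)) ⟩
      ∑ r (λ i → sub i + onDiag c i) + ∑ r (super ∘ suc) + X
        ≡⟨ cong (λ s → s + ∑ r (super ∘ suc) + X) (∑-add r sub (onDiag c)) ⟩
      ∑ r sub + A + ∑ r (super ∘ suc) + X ∎
    neighbours : ∑ r super + ∑ r (sub ∘ suc) ≡ A + ∑ r excess
    neighbours = trans (sym (∑-add r super (sub ∘ suc)))
      (trans (∑-cong r neighbour) (∑-add r (onDiag c) excess))
    rearrange₁ : ∀ s A t X x u p R → s + A + t + X + (x + u + p + R) ≡ (s + u) + t + A + p + R + X + x
    rearrange₁ s A t X x u p R = solve (s ∷ A ∷ t ∷ X ∷ x ∷ u ∷ p ∷ R ∷ [])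
    rearrange₂ : ∀ s t u A p R X x → s + (t + u) + A + p + R + X + x ≡ (t + s) + A + p + R + (u + X + x)
    rearrange₂ s t u A p R X x = solve (s ∷ t ∷ u ∷ A ∷ p ∷ R ∷ X ∷ x ∷ [])
    rearrange₃ : ∀ A e p R s X x → A + e + A + p + R + (s + X + x) ≡ A + A + p + R + (e + s + X + x)
    rearrange₃ A e p R s X x = solve (A ∷ e ∷ p ∷ R ∷ s ∷ X ∷ x ∷ [])

  -- The two estimates combined. By `total` few diagonal 1s mean many 1s in the right half of `c m`;
  -- by `crossing`, where the partial sum of row `r` goes from `c r r` at the middle to 1 at the
  -- end, many 1s there mean many survivors. Twice `budget` makes `A` cancel.
  balance : U + U + p ≡ R00 + R11 + r + (σ + σ)
  balance = +-cancelʳ-≡ (p + (y + y)) _ _ (begin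
    U + U + p + (p + (y + y))
      ≡⟨ cong (λ u → u + u + p + (p + (y + y))) budget ⟩
    (A + A + p + R11 + σ) + (A + A + p + R11 + σ) + p + (p + (y + y))
      ≡⟨ rearrange₁ A p R11 σ y ⟩
    ((A + p) + (A + p) + y) + ((A + p) + (A + p) + y) + (R11 + R11 + (σ + σ))
      ≡⟨ cong (λ z → z + z + (R11 + R11 + (σ + σ))) total ⟩
    m + m + (R11 + R11 + (σ + σ))
      ≡⟨ rearrange₂ r R11 σ ⟩
    (R11 + m + 1) + (R11 + r + (σ + σ))
      ≡⟨ cong (_+ (R11 + r + (σ + σ))) crossing ⟩
    (R00 + (y + y) + p) + (R11 + r + (σ + σ))
      ≡⟨ rearrange₃ R00 y p R11 r σ ⟩
    R00 + R11 + r + (σ + σ) + (p + (y + y)) ∎)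
    where
    open ≡-Reasoning
    y : ℕ
    y = ∑ m (λ j → bit c m (m + j))
    total : (A + p) + (A + p) + y ≡ m
    total = trans (cong (_+ y) (sym (corner-total P m m≤n)))
      (trans (sym (∑-split m m (bit c m))) (row-total P m m≤n))
    crossing : R11 + m + 1 ≡ R00 + (y + y) + p
    crossing = trans (cong (λ b → R11 + m + ι b) (sym (bottom {r} m≤n)))
      (trans (defect P m≤n m m ≤-refl) (cong (λ b → R00 + (y + y) + ι b) (diag m≤n)))
    rearrange₁ : ∀ A p R s y → (A + A + p + R + s) + (A + A + p + R + s) + p + (p + (y + y))
                 ≡ ((A + p) + (A + p) + y) + ((A + p) + (A + p) + y) + (R + R + (s + s))
    rearrange₁ A p R s y = solve (A ∷ p ∷ R ∷ s ∷ y ∷ [])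
    rearrange₂ : ∀ r R s → suc r + suc r + (R + R + (s + s)) ≡ (R + suc r + 1) + (R + r + (s + s))
    rearrange₂ r R s = solve (r ∷ R ∷ s ∷ [])
    rearrange₃ : ∀ Z y p R r s → (Z + (y + y) + p) + (R + r + (s + s)) ≡ Z + R + r + (s + s) + (p + (y + y))
    rearrange₃ Z y p R r s = solve (Z ∷ y ∷ p ∷ R ∷ r ∷ s ∷ [])

  half≤loss : ∀ {k} → r ≡ k + k → k ≤ U
  half≤loss refl = halve {a = R00} {R11} {σ + σ} (ι≤1 (c r r)) balance

  module Tight {k} (r≡k+k : r ≡ k + k) (U≡k : U ≡ k) where

    -- In case of equality everything that `half≤loss` drops must fit into `p`, which is at most 1.
    -- The surplus `σ` occurs doubled and therefore vanishes.
    slack : p ≡ R00 + R11 + (σ + σ)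
    slack = +-cancelˡ-≡ r p _ (trans (trans (cong (_+ p) (trans r≡k+k (sym (cong₂ _+_ U≡k U≡k)))) balance)
      (rearrange R00 R11 r (σ + σ)))
      where
      rearrange : ∀ a b r s → a + b + r + s ≡ r + (a + b + s)
      rearrange a b r s = solve (a ∷ b ∷ r ∷ s ∷ [])

    σ≡0 : σ ≡ 0
    σ≡0 = slack≡0 {a = R00 + R11} (ι≤1 (c r r)) slack

    superDiag-last : superDiag c r ≡ 0
    superDiag-last = m+n≡0⇒n≡0 (∑ r excess) (m+n≡0⇒m≡0 _ (m+n≡0⇒m≡0 _ σ≡0))

    excess≡0 : ∀ i → i < r → excess i ≡ 0
    excess≡0 = ∑-zero r excess (m+n≡0⇒m≡0 _ (m+n≡0⇒m≡0 _ (m+n≡0⇒m≡0 _ σ≡0)))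

    remote≡0 : ∀ i → i < r → remote i ≡ 0
    remote≡0 = ∑-zero r remote (m+n≡0⇒n≡0 (∑ r excess + superDiag c r) (m+n≡0⇒m≡0 _ σ≡0))

    R00+R11 : p ≡ R00 + R11
    R00+R11 = trans slack (trans (cong (λ s → R00 + R11 + (s + s)) σ≡0) (+-identityʳ _))

    -- The entry right of the diagonal in the last row is 0 if p = 1: a second 1 next to the
    -- surviving one would come from a survivor counted in superDiag.
    p⇒corner : c r r ≡ true → c r m ≡ false × c m m ≡ false
    p⇒corner crr with c r m in eq
    ... | true  = contradiction (≤-trans (created r crr eq m<n) (≤-reflexive superDiag-last)) λ ()
      where
      m<n : m < n
      m<n = m<m+n m (s≤s z≤n)
      created : ∀ r → c r r ≡ true → c r (suc r) ≡ true → suc r < n → 1 ≤ superDiag c r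
      created zero    a b l = contradiction (trans (sym (top (<-trans (s≤s z≤n) l))) a) λ ()
      created (suc r) a b l = adjacent P (<-trans (<-trans (n<1+n r) (n<1+n _)) l) l a b
    ... | false = refl , level (vertex m≤n (m<m+n m (s≤s z≤n))) (trans (diag m≤n) crr) eq
      where
      level : ∀ {x y h h′} → Vertex x y h h′ → h ≡ true → x ≡ false → y ≡ false
      level stay _ eq = eq
      level minus _ _ = refl

    neither-corner : c r r ≡ true → neither c r m ≡ 1
    neither-corner crr rewrite proj₁ (p⇒corner crr) | proj₂ (p⇒corner crr) = refl

    -- Only `p` cells are left for `R00` and `R11` together. If `p` is 1, the cell of
    -- `neither-corner` uses this up, and nothing remains for `R11`.
    R00≡p : R00 ≡ p
    R11≡0 : R11 ≡ 0

    R11≡0 with c r r in eq | R00+R11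
    ... | false | q = m+n≡0⇒n≡0 R00 (sym q)
    ... | true  | q = n≤0⇒n≡0 (+-cancelˡ-≤ 1 _ _ (≤-trans (+-monoˡ-≤ R11 one) (≤-reflexive (sym q))))
      where
      one : 1 ≤ R00
      one = ≤-trans (≤-reflexive (sym (trans (cong (neither c r) (+-identityʳ m)) (neither-corner eq))))
        (≤-trans (m≤m+n _ _) (≤-reflexive (sym (∑-head r (λ j → neither c r (m + j))))))

    R00≡p = sym (trans R00+R11 (trans (cong (R00 +_) R11≡0) (+-identityʳ R00)))

    -- Hence the parity of `k` alone decides whether the last diagonal cell carries a 1; this starts
    -- the comparison of two extremal configurations.
    count : k ≡ A + A + p
    count = trans (sym U≡k) (trans budget (trans (cong₂ (λ a b → A + A + p + a + b) R11≡0 σ≡0)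
      (trans (+-identityʳ _) (+-identityʳ _))))

    both-right : ∀ j → j < m → both c r (m + j) ≡ 0
    both-right = ∑-zero m _ R11≡0

    neither-right : ∀ j → suc j < m → neither c r (m + suc j) ≡ 0
    neither-right j (s≤s j<r) = ∑-zero r (λ j → neither c r (m + suc j)) rest j j<r
      where
      rest : ∑ r (λ j → neither c r (m + suc j)) ≡ 0
      rest with c r r in eq | trans (sym (∑-head r (λ j → neither c r (m + j)))) R00≡p
      ... | false | q = m+n≡0⇒n≡0 (neither c r (m + 0)) q
      ... | true  | q = +-cancelˡ-≡ 1 _ _ (trans (cong (_+ ∑ r (λ j → neither c r (m + suc j)))
        (sym (trans (cong (neither c r) (+-identityʳ m)) (neither-corner eq)))) q)

    neither-middle : c r r ≡ false → neither c r m ≡ 0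
    neither-middle eq = trans (cong (neither c r) (sym (+-identityʳ m)))
      (∑-zero m _ (trans R00≡p (cong ι eq)) 0 (s≤s z≤n))

    survivor-left : ∀ i j → i ≤ r → suc j < i → both c i j ≡ 0
    survivor-left (suc i) j i≤r (s≤s j<i) with m≤n⇒m<n∨m≡n i≤r
    ... | inj₁ i<r  = ∑-zero i (both c (suc i)) (m+n≡0⇒m≡0 _ (remote≡0 (suc i) i<r)) j j<i
    ... | inj₂ refl = ∑-zero i (both c (suc i)) (m+n≡0⇒n≡0 (∑ r excess + superDiag c r + ∑ r remote) σ≡0) j j<i

    survivor-right : ∀ i j → i ≤ r → m ≤ j → j < n → both c i j ≡ 0
    survivor-right i j i≤r m≤j j<n with m≤n⇒m<n∨m≡n i≤r
    ... | inj₂ refl = trans (cong (both c i) (sym (m+[n∸m]≡n m≤j)))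
      (both-right (j ∸ m) (+-cancelˡ-< m _ _ (≤-trans (≤-reflexive (cong suc (m+[n∸m]≡n m≤j))) j<n)))
    ... | inj₁ i<r with 3 + i ≤? j
    ...   | yes 3+i≤j = trans (cong (both c i) (sym (m+[n∸m]≡n 3+i≤j)))
      (∑-zero (n ∸ (3 + i)) _ (m+n≡0⇒n≡0 (∑ (i ∸ 1) (both c i)) (remote≡0 i i<r)) (j ∸ (3 + i)) (∸-monoˡ-< j<n 3+i≤j))
    -- Here `j` is both `i + 2` and `m`, so `i` is `r - 1` and the cell is the second one of
    -- `superDiag c r`.
    ...   | no  j<3+i
      with refl ← ≤-antisym (s≤s⁻¹ (≰⇒> j<3+i)) (≤-trans (s≤s i<r) m≤j)
      with refl ← ≤-antisym i<r (s≤s⁻¹ m≤j) = m+n≡0⇒n≡0 (both c i (suc i)) superDiag-last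

    -- Such a survivor would sit at a 0 entry with partial row sum 1 on both sides. By symmetry
    -- `c i` then has 1s in columns `i` and `i + 1`, one of which survived the row above: two
    -- survivors charged to the diagonal 1 at `i`, while zero `excess` allows one.
    no-adjacent-diag : ∀ i → suc i ≤ r → c (suc i) (suc i) ≡ true → both c (suc i) i ≡ 0
    no-adjacent-diag zero    i<r p₁
      rewrite diag {0} (s≤s z≤n) | top {0} (s≤s z≤n) = refl
    no-adjacent-diag (suc i) i<r p₁ = excluded (both c (suc (suc i)) (suc i)) refl
      where
      i+2<n : suc (suc i) < n
      i+2<n = ≤-trans (s≤s i<r) m≤n
      level : ∀ {x y h h′} → Vertex x y h h′ → h′ ≡ true → ι (x ∧ y) ≢ 0 → h ≡ true
      level stay  q _ = q
      level plus  _ b = contradiction refl b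
      upper-one : ∀ {x y} → ι (x ∧ y) ≢ 0 → x ≡ true
      upper-one {false} b = contradiction refl b
      upper-one {true}  _ = refl
      cramped : superDiag c (suc i) + both c (suc (suc i)) (suc i) ≤ 1
      cramped = ≤-trans (≤-reflexive (trans (neighbour (suc i) i<r)
        (trans (cong (onDiag c (suc i) +_) (excess≡0 (suc i) i<r)) (+-identityʳ _)))) (ι≤1 (c (suc i) (suc i)))
      excluded : ∀ t → both c (suc (suc i)) (suc i) ≡ t → both c (suc (suc i)) (suc i) ≡ 0
      excluded zero    b = b
      excluded (suc t) b = contradiction (≤-trans (adjacent P (<-trans (<-trans (n<1+n i) (n<1+n _)) i+2<n) i+2<n
          (trans (sym (diag (<⇒≤ i+2<n))) (upper-one nonzero)) (level (vertex i+2<n (<⇒≤ i+2<n)) p₁ nonzero))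
        (s≤s⁻¹ (≤-trans (s≤s (m≤m+n _ t)) (≤-trans (≤-reflexive (sym (+-suc _ t)))
          (subst (λ t → superDiag c (suc i) + t ≤ 1) b cramped))))) λ ()
        where
        nonzero : both c (suc (suc i)) (suc i) ≢ 0
        nonzero e = contradiction (trans (sym e) b) λ ()

-- Rigidity in the case of equality

parity-bit : ∀ a b {x y} → a + a + ι x ≡ b + b + ι y → x ≡ y
parity-bit zero    zero    eq = ι-injective eq
parity-bit (suc a) (suc b) {x} {y} eq = parity-bit a b (suc-injective (suc-injective
  (trans (cong (λ z → suc (z + ι x)) (sym (+-suc a a))) (trans eq (cong (λ z → suc (z + ι y)) (+-suc b b))))))
parity-bit zero    (suc b) {x} {y} eq = impossible (b + b + ι y) (ι≤1 x) (trans (e b (ι y)) (sym eq))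
  where
  e : ∀ b y → 1 + (b + b + y) + 1 ≡ suc b + suc b + y
  e b y = solve (b ∷ y ∷ [])
parity-bit (suc a) zero    eq = sym (parity-bit zero (suc a) (sym eq))

vertex-above : ∀ {x y h h′ x₁ y₁ h₁ h₁′} → Vertex x y h h′ → Vertex x₁ y₁ h₁ h₁′ →
  y ≡ y₁ → h ≡ h₁ → h′ ≡ h₁′ → x ≡ x₁
vertex-above stay  stay  refl _    _    = refl
vertex-above stay  plus  _    refl ()
vertex-above stay  minus _    refl ()
vertex-above plus  stay  _    refl ()
vertex-above plus  plus  _    _    _    = refl
vertex-above minus stay  _    refl ()
vertex-above minus minus _    _    _    = refl

vertex-nonzero : ∀ {x y h h′} → Vertex x y h h′ → ι (x ∧ y) ≡ 0 → ι (not x ∧ not y) ≡ 0 →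
  y ≡ not h × h′ ≡ not h
vertex-nonzero (stay {false}) _ ()
vertex-nonzero (stay {true}) ()
vertex-nonzero plus  _ _ = refl , refl
vertex-nonzero minus _ _ = refl , refl

vertex-one : ∀ {x y h h′} → Vertex x y h h′ → y ≡ true → ι (x ∧ y) ≡ 0 → h ≡ false × h′ ≡ true
vertex-one stay refl ()
vertex-one plus _ _ = refl , refl

vertex-one-left : ∀ {x y h h′} → Vertex x y h h′ → y ≡ true → h′ ≡ false → h ≡ false
vertex-one-left stay  _ q = q

vertex-zero-left : ∀ {x y h h′} → Vertex x y h h′ → y ≡ false → h ≡ false → h′ ≡ false
vertex-zero-left stay  _ q = q
vertex-zero-left minus _ _ = refl

vertex-zero-right : ∀ {x y h h′} → Vertex x y h h′ → y ≡ false → h′ ≡ true → h ≡ true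
vertex-zero-right stay  _ q = q
vertex-zero-right minus _ ()

-- The ways in which the word y of partial column sums below a row pins down the partial row sum
-- at position J, provided that no 1 next to J survives the row.
data PinnedLeft (y : ℕ → Bool) (J : ℕ) : Set where
  empty  : (∀ j → j < J → y j ≡ false) → PinnedLeft y J
  after  : ∀ j → J ≡ suc j → y j ≡ true → PinnedLeft y J
  before : y J ≡ true → PinnedLeft y J

data PinnedRight (n : ℕ) (y : ℕ → Bool) (J : ℕ) : Set where
  empty  : (∀ j → J ≤ j → j < n → y j ≡ false) → PinnedRight n y J
  after  : ∀ j → J ≡ suc j → y j ≡ true → PinnedRight n y J
  before : J < n → y J ≡ true → PinnedRight n y J

leftValue : ∀ {y J} → PinnedLeft y J → Bool
leftValue (empty _)     = false
leftValue (after _ _ _) = true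
leftValue (before _)    = false

rightValue : ∀ {n y J} → PinnedRight n y J → Bool
rightValue (empty _)     = true
rightValue (after _ _ _) = true
rightValue (before _ _)  = false

module _ {r k c} (P : Path (suc r + suc r) c) (r≡k+k : r ≡ k + k)
         (tight : loss (suc r) (suc r + suc r) c ≡ k) where
  open Path P
  open Budget P using (module Tight)
  open Tight r≡k+k tight
  private
    m n : ℕ
    m = suc r
    n = m + m

    m≤n : m ≤ n
    m≤n = m≤m+n m m

  -- Where no 1 survives, a 1 of `y` comes from an entry +1, so the partial row sum is 0 before and
  -- 1 after it. Over a stretch without 1s no entry is +1, and the initial 0 persists.
  pinned-left : ∀ {i J} y → i ≤ r → J < i → (∀ j → j < n → c (suc i) j ≡ y j) →
    (pin : PinnedLeft y J) → c J i ≡ leftValue pin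
  pinned-left {i} {J} y i≤r J<i agree (empty z) = prefix J ≤-refl
    where
    prefix : ∀ l → l ≤ J → c l i ≡ false
    prefix zero    _   = top (≤-trans (s≤s i≤r) m≤n)
    prefix (suc l) l<J = vertex-zero-left (vertex (≤-trans (s≤s i≤r) m≤n) l<n) (trans (agree l l<n) (z l l<J)) (prefix l (<⇒≤ l<J))
      where
      l<n : l < n
      l<n = ≤-trans (≤-trans l<J (<⇒≤ J<i)) (≤-trans i≤r (≤-trans (n≤1+n r) m≤n))
  pinned-left {i} y i≤r J<i agree (after j refl yj) =
    proj₂ (vertex-one (vertex (≤-trans (s≤s i≤r) m≤n) j<n) (trans (agree j j<n) yj) (survivor-left i j i≤r J<i))
    where
    j<n : j < n
    j<n = ≤-trans (<⇒≤ J<i) (≤-trans i≤r (≤-trans (n≤1+n r) m≤n))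
  pinned-left {i} {J} y i≤r J<i agree (before yJ) with m≤n⇒m<n∨m≡n J<i
  ... | inj₁ sJ<i = proj₁ (vertex-one (vertex (≤-trans (s≤s i≤r) m≤n) J<n) (trans (agree J J<n) yJ) (survivor-left i J i≤r sJ<i))
    where
    J<n : J < n
    J<n = ≤-trans J<i (≤-trans i≤r (≤-trans (n≤1+n r) m≤n))
  -- Column `J` is now next to the diagonal and out of reach of `survivor-left`. If `c i i` is 0, it
  -- is enough that the entry is not -1.
  ... | inj₂ refl = byCases (c i i) refl
    where
    i<n : i < n
    i<n = ≤-trans (s≤s i≤r) m≤n
    J<n : J < n
    J<n = <⇒≤ i<n
    byCases : ∀ b → c i i ≡ b → c J i ≡ false
    byCases false eq = vertex-one-left (vertex i<n J<n) (trans (agree J J<n) yJ) eq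
    byCases true  eq = proj₁ (vertex-one (vertex i<n J<n) (trans (agree J J<n) yJ) (no-adjacent-diag J i≤r eq))

  -- As for `pinned-left`, but starting from the right end, where the partial row sum is 1. `m < J`
  -- keeps column `J - 1` within the range of `survivor-right`.
  pinned-right : ∀ {i J} y → i ≤ r → m < J → J ≤ n → (∀ j → j < n → c (suc i) j ≡ y j) →
    (pin : PinnedRight n y J) → c J i ≡ rightValue pin
  pinned-right {i} {J} y i≤r m<J J≤n agree (empty z) = suffix (n ∸ J) J (m∸n+n≡m J≤n) ≤-refl
    where
    suffix : ∀ l L → l + L ≡ n → J ≤ L → c L i ≡ true
    suffix zero    L refl _   = bottom (≤-trans (s≤s i≤r) m≤n)
    suffix (suc l) L eq   J≤L = vertex-zero-right (vertex (≤-trans (s≤s i≤r) m≤n) L<n)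
        (trans (agree L L<n) (z L J≤L L<n)) (suffix l (suc L) (trans (+-suc l L) eq) (m≤n⇒m≤1+n J≤L))
      where
      L<n : L < n
      L<n = ≤-trans (s≤s (m≤n+m L l)) (≤-reflexive eq)
  pinned-right {i} y i≤r m<J J≤n agree (after j refl yj) =
    proj₂ (vertex-one (vertex (≤-trans (s≤s i≤r) m≤n) J≤n) (trans (agree j J≤n) yj)
      (survivor-right i j i≤r (s≤s⁻¹ m<J) J≤n))
  pinned-right {i} {J} y i≤r m<J J≤n agree (before J<n yJ) =
    proj₁ (vertex-one (vertex (≤-trans (s≤s i≤r) m≤n) J<n) (trans (agree J J<n) yJ)
      (survivor-right i J i≤r (<⇒≤ m<J) J<n))

-- What the comparison configuration must provide. On the right, row `r` is left out, since
-- `middleRow-right` determines it.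
record Shaped (r : ℕ) (d : ℕ → ℕ → Bool) : Set where
  field
    left  : ∀ {i J} → i ≤ r → J < i → PinnedLeft (d (suc i)) J
    right : ∀ {i J} → i < r → suc r < J → J ≤ suc r + suc r → PinnedRight (suc r + suc r) (d (suc i)) J

module _ {r k c d} (P : Path (suc r + suc r) c) (Q : Path (suc r + suc r) d) (r≡k+k : r ≡ k + k)
         (tight-c : loss (suc r) (suc r + suc r) c ≡ k) (tight-d : loss (suc r) (suc r + suc r) d ≡ k) where
  private
    m n : ℕ
    m = suc r
    n = m + m

    m≤n : m ≤ n
    m≤n = m≤m+n m m

    module P = Path P
    module Q = Path Q
    module BP = Budget P
    module BQ = Budget Q
    module TP = BP.Tight r≡k+k tight-c
    module TQ = BQ.Tight r≡k+k tight-d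

    shifted<n : ∀ {j} → j < m → m + j < n
    shifted<n = +-monoʳ-< m

  lastDiag-agree : c r r ≡ d r r
  lastDiag-agree = parity-bit BP.A BQ.A (trans (sym TP.count) TQ.count)

  -- If `c r r` is 1, `p⇒corner` makes the entry in column `m` of row `r` zero. Otherwise neither a
  -- 1 nor a 0 persists there, so the entry is nonzero and follows from `c m r`, which equals
  -- `c r r`.
  corner-agree : c m m ≡ d m m × c (suc m) r ≡ d (suc m) r
  corner-agree = byCases (c r r) refl
    where
    m<n : m < n
    m<n = m<m+n m (s≤s z≤n)
    kept : ∀ {x y h h′} → Vertex x y h h′ → x ≡ false → y ≡ false → h ≡ true → h′ ≡ true
    kept stay  _ _ q = q
    kept plus  _ () _
    kept minus () _ _
    byCases : ∀ b → c r r ≡ b → c m m ≡ d m m × c (suc m) r ≡ d (suc m) r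
    byCases true ec =
        trans (proj₂ (TP.p⇒corner ec)) (sym (proj₂ (TQ.p⇒corner ed)))
      , trans (kept (P.vertex m≤n m<n) (proj₁ (TP.p⇒corner ec)) (proj₂ (TP.p⇒corner ec)) (trans (P.diag m≤n) ec))
         (sym (kept (Q.vertex m≤n m<n) (proj₁ (TQ.p⇒corner ed)) (proj₂ (TQ.p⇒corner ed)) (trans (Q.diag m≤n) ed)))
      where
      ed : d r r ≡ true
      ed = trans (sym lastDiag-agree) ec
    byCases false ec =
        trans (proj₁ vc) (trans (cong not heads) (sym (proj₁ vd)))
      , trans (proj₂ vc) (trans (cong not heads) (sym (proj₂ vd)))
      where
      survivor-c : both c r m ≡ 0
      survivor-c = trans (cong (both c r) (sym (+-identityʳ m))) (TP.both-right 0 (s≤s z≤n))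
      survivor-d : both d r m ≡ 0
      survivor-d = trans (cong (both d r) (sym (+-identityʳ m))) (TQ.both-right 0 (s≤s z≤n))
      vc : c m m ≡ not (c m r) × c (suc m) r ≡ not (c m r)
      vc = vertex-nonzero (P.vertex m≤n m<n) survivor-c (TP.neither-middle ec)
      vd : d m m ≡ not (d m r) × d (suc m) r ≡ not (d m r)
      vd = vertex-nonzero (Q.vertex m≤n m<n) survivor-d (TQ.neither-middle (trans (sym lastDiag-agree) ec))
      heads : c m r ≡ d m r
      heads = trans (P.diag m≤n) (trans lastDiag-agree (sym (Q.diag m≤n)))

  -- Beyond column `m` all entries of row `r` are nonzero, so its partial sums alternate and are
  -- fixed by the first of them.
  middleRow-right : ∀ j → j ≤ m → c (m + j) r ≡ d (m + j) r
  middleRow-right zero _ = trans (cong (λ z → c z r) (+-identityʳ m))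
    (trans (trans (P.diag m≤n) (trans lastDiag-agree (sym (Q.diag m≤n)))) (cong (λ z → d z r) (sym (+-identityʳ m))))
  middleRow-right (suc zero) _ = trans (cong (λ z → c z r) (+-comm m 1))
    (trans (proj₂ corner-agree) (cong (λ z → d z r) (+-comm 1 m)))
  middleRow-right (suc (suc j)) j<m = trans (cong (λ z → c z r) (+-suc m (suc j)))
    (trans (proj₂ (vertex-nonzero (P.vertex m≤n (shifted<n j<m)) (TP.both-right (suc j) j<m) (TP.neither-right j j<m)))
    (trans (cong not (middleRow-right (suc j) (<⇒≤ j<m)))
    (trans (sym (proj₂ (vertex-nonzero (Q.vertex m≤n (shifted<n j<m)) (TQ.both-right (suc j) j<m) (TQ.neither-right j j<m))))
    (cong (λ z → d z r) (sym (+-suc m (suc j)))))))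

  middle-right : ∀ j → j < m → c m (m + j) ≡ d m (m + j)
  middle-right zero _ = trans (cong (c m) (+-identityʳ m)) (trans (proj₁ corner-agree) (cong (d m) (sym (+-identityʳ m))))
  middle-right (suc j) j<m =
    trans (proj₁ (vertex-nonzero (P.vertex m≤n (shifted<n j<m)) (TP.both-right (suc j) j<m) (TP.neither-right j j<m)))
    (trans (cong not (middleRow-right (suc j) (<⇒≤ j<m)))
    (sym (proj₁ (vertex-nonzero (Q.vertex m≤n (shifted<n j<m)) (TQ.both-right (suc j) j<m) (TQ.neither-right j j<m)))))

  module _ (shape : Shaped r d) (middle : ∀ j → j < n → c m j ≡ d m j) where

    private
      Agree : ℕ → Set
      Agree i = ∀ j → j < n → c i j ≡ d i j

    -- Symmetry turns the rows already known below row i into the partial sums of row i itself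
    -- between the diagonal and the middle; the shape of d pins down the remaining ones.
    row-heads : ∀ i → i ≤ r → (∀ i′ → i < i′ → i′ ≤ m → Agree i′) → ∀ J → J ≤ n → c J i ≡ d J i
    row-heads i i≤r known J J≤n with <-cmp J i
    ... | tri< J<i _ _ = trans (pinned-left P r≡k+k tight-c (d (suc i)) i≤r J<i (known (suc i) ≤-refl (s≤s i≤r)) (Shaped.left shape i≤r J<i))
      (sym (pinned-left Q r≡k+k tight-d (d (suc i)) i≤r J<i (λ _ _ → refl) (Shaped.left shape i≤r J<i)))
    ... | tri≈ _ refl _ = trans (sym (P.diag i<n)) (trans (known (suc i) ≤-refl (s≤s i≤r) i i<n) (Q.diag i<n))
      where
      i<n : i < n
      i<n = ≤-trans (s≤s i≤r) m≤n
    ... | tri> _ _ i<J with J ≤? m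
    ...   | yes J≤m = known J i<J J≤m i (≤-trans (s≤s i≤r) m≤n)
    ...   | no  J≰m with m≤n⇒m<n∨m≡n i≤r
    ...     | inj₁ i<r = trans (pinned-right P r≡k+k tight-c (d (suc i)) i≤r (≰⇒> J≰m) J≤n (known (suc i) ≤-refl (s≤s i≤r)) (Shaped.right shape i<r (≰⇒> J≰m) J≤n))
      (sym (pinned-right Q r≡k+k tight-d (d (suc i)) i≤r (≰⇒> J≰m) J≤n (λ _ _ → refl) (Shaped.right shape i<r (≰⇒> J≰m) J≤n)))
    ...     | inj₂ refl = trans (cong (λ z → c z i) (sym m+[J-m]))
      (trans (middleRow-right (J ∸ m) (+-cancelˡ-≤ m _ _ (≤-trans (≤-reflexive m+[J-m]) J≤n))) (cong (λ z → d z i) m+[J-m]))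
      where
      m+[J-m] : m + (J ∸ m) ≡ J
      m+[J-m] = m+[n∸m]≡n (<⇒≤ (≰⇒> J≰m))

    -- `t` bounds the distance to the middle row. The induction moves upwards from there, with all
    -- rows in between at hand, as `row-heads` requires.
    rows-agree : ∀ t i → i ≤ m → m ≤ t + i → ∀ j → j < n → c i j ≡ d i j
    rows-agree zero    i i≤m m≤i j j<n with refl ← ≤-antisym i≤m m≤i = middle j j<n
    rows-agree (suc t) i i≤m m≤t+i j j<n with m≤n⇒m<n∨m≡n i≤m
    ... | inj₂ refl = middle j j<n
    ... | inj₁ i<m = vertex-above (P.vertex i<n j<n) (Q.vertex i<n j<n)
        (known (suc i) ≤-refl i<m j j<n) (heads j (<⇒≤ j<n)) (heads (suc j) j<n)
      where
      i<n : i < n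
      i<n = ≤-trans i<m m≤n
      known : ∀ i′ → i < i′ → i′ ≤ m → Agree i′
      known i′ i<i′ i′≤m = rows-agree t i′ i′≤m (≤-trans m≤t+i (≤-trans (≤-reflexive (sym (+-suc t i))) (+-monoʳ-≤ t i<i′)))
      heads : ∀ J → J ≤ n → c J i ≡ d J i
      heads = row-heads i (s≤s⁻¹ i<m) known

-- Rotation, and passage from matrices to partial sums

-- The partial sums of the matrix rotated by 180°: every column has sum 1, so its last `i` entries
-- add up to the complement of the rest.
rot : ℕ → (ℕ → ℕ → Bool) → ℕ → ℕ → Bool
rot n c i j = not (c (n ∸ i) (n ∸ suc j))

∸-suc-< : ∀ {i n} → i < n → n ∸ i ≡ suc (n ∸ suc i)
∸-suc-< {i} (s≤s i≤n) = +-∸-assoc 1 i≤n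

∸-suc-bound : ∀ {i n} → i < n → n ∸ suc i < n
∸-suc-bound {i} i<n = ≤-trans (≤-reflexive (sym (∸-suc-< i<n))) (m∸n≤m _ i)

vertex-rot : ∀ {x y h h′} → Vertex x y h h′ → Vertex (not y) (not x) (not h′) (not h)
vertex-rot stay  = stay
vertex-rot plus  = plus
vertex-rot minus = minus

rot-path : ∀ {n c} → Path n c → Path n (rot n c)
rot-path {n} {c} P = record
  { top    = λ j<n → cong not (bottom (∸-suc-bound j<n))
  ; bottom = λ {j} j<n → cong not (trans (cong (λ i → c i (n ∸ suc j)) (n∸n≡0 n)) (top (∸-suc-bound j<n)))
  ; vertex = λ {i} {j} i<n j<n → subst₂ (λ a b → Vertex (not (c a (n ∸ suc j))) (rot n c (suc i) j) (not (c b (n ∸ suc i))) (rot n c (suc j) i))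
      (sym (∸-suc-< i<n)) (sym (∸-suc-< j<n)) (vertex-rot (vertex (∸-suc-bound i<n) (∸-suc-bound j<n)))
  ; diag   = λ {i} i<n → cong not (trans (sym (diag (∸-suc-bound i<n))) (cong (λ a → c a (n ∸ suc i)) (sym (∸-suc-< i<n))))
  }
  where open Path P

changes : ℕ → (ℕ → ℕ → Bool) → ℕ
changes n c = ∑ n λ i → ∑ n (change c i)

change-rot : ∀ {n} c {i j} → i < n → change (rot n c) i j ≡ change c (n ∸ suc i) (n ∸ suc j)
change-rot {n} c {i} {j} i<n rewrite ∸-suc-< i<n with c (suc (n ∸ suc i)) (n ∸ suc j) | c (n ∸ suc i) (n ∸ suc j)
... | false | false = refl
... | false | true  = refl
... | true  | false = refl
... | true  | true  = refl

changes-below : ∀ m c → ∑ m (λ i → ∑ (m + m) (change c (m + i))) ≡ ∑ m (λ i → ∑ (m + m) (change (rot (m + m) c) i))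
changes-below m c = trans (∑-reverse m (λ i → ∑ n (change c (m + i)))) (∑-cong m λ i i<m →
  trans (cong (λ a → ∑ n (change c a)) (sym (+-∸-assoc m i<m)))
  (trans (∑-reverse n (change c (n ∸ suc i))) (∑-cong n λ j j<n → sym (change-rot c (≤-trans i<m (m≤m+n m m))))))
  where
  n : ℕ
  n = m + m

total-changes : ∀ {m c} → Path (m + m) c → let n = m + m ; U = loss m n c ; L = loss m n (rot n c) in
  changes n c + (U + U + (L + L)) ≡ m * m + m * m
total-changes {m} {c} P = begin
  changes n c + (U + U + (L + L))
    ≡⟨ cong (_+ (U + U + (L + L))) (trans (∑-split m m (λ i → ∑ n (change c i))) (cong (upper +_) (changes-below m c))) ⟩
  upper + lower + (U + U + (L + L))
    ≡⟨ rearrange upper lower U L ⟩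
  (upper + (U + U)) + (lower + (L + L))
    ≡⟨ cong₂ _+_ (changes-above P m (m≤m+n m m)) (changes-above (rot-path P) m (m≤m+n m m)) ⟩
  m * m + m * m ∎
  where
  open ≡-Reasoning
  n U L upper lower : ℕ
  n = m + m
  U = loss m n c
  L = loss m n (rot n c)
  upper = ∑ m (λ i → ∑ n (change c i))
  lower = ∑ m (λ i → ∑ n (change (rot n c) i))
  rearrange : ∀ a b u l → a + b + (u + u + (l + l)) ≡ (a + (u + u)) + (b + (l + l))
  rearrange a b u l = solve (a ∷ b ∷ u ∷ l ∷ [])

-- Alternating lists and their running sums

difference : Bool → Bool → ℤ
difference false true  = pos 1
difference true  false = -[1+ 0 ]
difference false false = pos 0
difference true  true  = pos 0

-- Continues b xs: the list xs alternates and brings the running sum from b to 1.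
data Continues : Bool → List ℤ → Set where
  done : Continues true []
  up   : ∀ {xs} → Continues true xs → Continues false (pos 1 ∷ xs)
  down : ∀ {xs} → Continues false xs → Continues true (-[1+ 0 ] ∷ xs)

alternating⇒continues : ∀ {xs} → Alternating xs → Continues false xs
alternating⇒continues alt-one      = up done
alternating⇒continues (alt-step a) = up (down (alternating⇒continues a))

continues⇒alternating : ∀ {xs} → Continues false xs → Alternating xs
continues⇒alternating (up done)     = alt-one
continues⇒alternating (up (down a)) = alt-step (continues⇒alternating a)

record Prefix {n : ℕ} (f : Fin n → ℤ) (b : Bool) (p : ℕ → Bool) : Set where
  constructor prefix
  field
    start : p 0 ≡ b
    end   : p n ≡ true
    step  : ∀ j → f j ≡ difference (p (toℕ j)) (p (suc (toℕ j)))

continues⇒prefix : ∀ {n} (f : Fin n → ℤ) b → Continues b (nonzeros (tabulate f)) → ∃[ p ] Prefix f b p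
continues⇒prefix {zero}  f _ done = (λ _ → true) , prefix refl refl λ ()
continues⇒prefix {suc n} f b a = extend (f Fin.zero) refl a
  where
  cons : Bool → (ℕ → Bool) → ℕ → Bool
  cons b p zero    = b
  cons b p (suc j) = p j
  glue : ∀ {b b′} → f Fin.zero ≡ difference b b′ → ∃[ p ] Prefix (f ∘ Fin.suc) b′ p → ∃[ p ] Prefix f b p
  glue {b} eq (p , prefix p0 pn step) = cons b p , prefix refl pn λ
    { Fin.zero    → trans eq (cong (difference b) (sym p0))
    ; (Fin.suc j) → step j }
  extend : ∀ x → f Fin.zero ≡ x → Continues b (nonzeros (x ∷ tabulate (f ∘ Fin.suc))) → ∃[ p ] Prefix f b p
  extend (pos 0)      eq a        = glue {b} {b} (trans eq (constant b)) (continues⇒prefix (f ∘ Fin.suc) b a)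
    where
    constant : ∀ b → pos 0 ≡ difference b b
    constant false = refl
    constant true  = refl
  extend (pos 1)      eq (up a)   = glue eq (continues⇒prefix (f ∘ Fin.suc) true a)
  extend (-[1+ 0 ]) eq (down a) = glue eq (continues⇒prefix (f ∘ Fin.suc) false a)

prefix⇒continues : ∀ {n} (f : Fin n → ℤ) b p → Prefix f b p → Continues b (nonzeros (tabulate f))
prefix⇒continues {zero}  f b p (prefix p0 pn _) rewrite trans (sym p0) pn = done
prefix⇒continues {suc n} f b p (prefix p0 pn step)
  with f Fin.zero | p 0 | p 1 | p0 | step Fin.zero
     | prefix⇒continues (f ∘ Fin.suc) (p 1) (p ∘ suc) (prefix refl pn (step ∘ Fin.suc))
... | _ | false | false | refl | refl | a = a
... | _ | false | true  | refl | refl | a = up a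
... | _ | true  | false | refl | refl | a = down a
... | _ | true  | true  | refl | refl | a = a

private
  all< : ∀ {n} (Q : ℕ → Set) → (∀ (i : Fin n) → Q (toℕ i)) → ∀ {i} → i < n → Q i
  all< Q h i<n = subst Q (toℕ-fromℕ< i<n) (h (fromℕ< i<n))

difference-vertex : ∀ x y h h′ → difference x y ≡ difference h h′ → Vertex x y h h′
difference-vertex false false false false _ = stay
difference-vertex false false true  true  _ = stay
difference-vertex true  true  false false _ = stay
difference-vertex true  true  true  true  _ = stay
difference-vertex false true  false true  _ = plus
difference-vertex true  false true  false _ = minus
difference-vertex false false false true  ()
difference-vertex false false true  false ()
difference-vertex true  true  false true  ()
difference-vertex true  true  true  false ()
difference-vertex false true  false false ()
difference-vertex false true  true  false ()
difference-vertex false true  true  true  ()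
difference-vertex true  false false false ()
difference-vertex true  false false true  ()
difference-vertex true  false true  true  ()

difference≡0 : ∀ x y → difference x y ≡ pos 0 → y ≡ x
difference≡0 false false _ = refl
difference≡0 true  true  _ = refl

module _ {n} {M : Matrix n} (symmetric : IsSymmetric M) where

  -- An entry and its mirror image are equal, and each is a difference of partial sums of its own
  -- row; two equal differences form a six-vertex configuration.
  rows⇒path : ZeroDiagonal M → ∀ c → (∀ i → Prefix (M i) false (λ j → c j (toℕ i))) → Path n c
  rows⇒path zeroDiag c rows = record
    { top    = all< (λ j → c 0 j ≡ false) λ j → Prefix.start (rows j)
    ; bottom = all< (λ j → c n j ≡ true) λ j → Prefix.end (rows j)
    ; vertex = λ {i} {j} i<n → all< (λ j → Vertex (c i j) (c (suc i) j) (c j i) (c (suc j) i)) (λ j →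
        all< (λ i → Vertex (c i (toℕ j)) (c (suc i) (toℕ j)) (c (toℕ j) i) (c (suc (toℕ j)) i)) (λ i →
          difference-vertex _ _ _ _ (trans (sym (entry j i)) (trans (symmetric j i) (entry i j)))) i<n) {j}
    ; diag   = all< (λ i → c (suc i) i ≡ c i i) λ i → difference≡0 _ _ (trans (sym (entry i i)) (zeroDiag i))
    }
    where
    entry : ∀ i j → M i j ≡ difference (c (toℕ j) (toℕ i)) (c (suc (toℕ j)) (toℕ i))
    entry i = Prefix.step (rows i)

  rows⇒entries : ∀ (c : ℕ → ℕ → Bool) → (∀ i → Prefix (M i) false (λ j → c j (toℕ i))) →
    ∀ i j → M i j ≡ difference (c (toℕ i) (toℕ j)) (c (suc (toℕ i)) (toℕ j))
  rows⇒entries c rows i j = trans (symmetric i j) (Prefix.step (rows j) i)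

  rows⇒symASM0 : ZeroDiagonal M → ∀ (c : ℕ → ℕ → Bool) → (∀ i → Prefix (M i) false (λ j → c j (toℕ i))) → IsSymASM0 M
  rows⇒symASM0 zeroDiag c rows = record
    { asm = record
      { entries = λ i j → subst IsSignEntry (sym (Prefix.step (rows i) j)) (sign _ _)
      ; rows    = λ i → continues⇒alternating (prefix⇒continues (M i) false _ (rows i))
      ; cols    = λ j → continues⇒alternating (prefix⇒continues (λ i → M i j) false (λ i → c i (toℕ j))
          (prefix (Prefix.start (rows j)) (Prefix.end (rows j)) λ i → trans (symmetric i j) (Prefix.step (rows j) i)))
      }
    ; sym  = symmetric
    ; diag = zeroDiag
    }
    where
    sign : ∀ x y → IsSignEntry (difference x y)
    sign false false = inj₁ refl
    sign false true  = inj₂ (inj₁ refl)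
    sign true  false = inj₂ (inj₂ refl)
    sign true  true  = inj₁ refl

extendFin : ∀ {n} → (Fin n → Bool) → ℕ → Bool
extendFin {zero}  f _       = false
extendFin {suc n} f zero    = f Fin.zero
extendFin {suc n} f (suc j) = extendFin (f ∘ Fin.suc) j

extendFin-toℕ : ∀ {n} (f : Fin n → Bool) j → extendFin f (toℕ j) ≡ f j
extendFin-toℕ f Fin.zero    = refl
extendFin-toℕ f (Fin.suc j) = extendFin-toℕ (f ∘ Fin.suc) j

rowSums : ∀ {n} {M : Matrix n} → IsASM M → ∃[ c ] (∀ i → Prefix (M i) false (λ j → c j (toℕ i)))
rowSums {M = M} asm = (λ j → extendFin λ i → proj₁ (sums i) j) , λ i → prefix
  (trans (extendFin-toℕ (λ i → proj₁ (sums i) 0) i) (Prefix.start (proj₂ (sums i))))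
  (trans (extendFin-toℕ (λ i → proj₁ (sums i) _) i) (Prefix.end (proj₂ (sums i))))
  (λ j → trans (Prefix.step (proj₂ (sums i)) j) (sym (cong₂ difference
    (extendFin-toℕ (λ i → proj₁ (sums i) (toℕ j)) i) (extendFin-toℕ (λ i → proj₁ (sums i) (suc (toℕ j))) i))))
  where
  sums : ∀ i → ∃[ p ] Prefix (M i) false p
  sums i = continues⇒prefix (M i) false (alternating⇒continues (IsASM.rows asm i))

length-nonzeros : ∀ {n} (f : Fin n → ℤ) g → (∀ j → length (nonzeros (f j ∷ [])) ≡ g (toℕ j)) →
  length (nonzeros (tabulate f)) ≡ ∑ n g
length-nonzeros {zero}  f g eq = refl
length-nonzeros {suc n} f g eq = trans (cons (f Fin.zero) _) (trans
  (cong₂ _+_ (eq Fin.zero) (length-nonzeros (f ∘ Fin.suc) (g ∘ suc) (eq ∘ Fin.suc))) (sym (∑-head n g)))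
  where
  cons : ∀ x xs → length (nonzeros (x ∷ xs)) ≡ length (nonzeros (x ∷ [])) + length (nonzeros xs)
  cons (pos zero)  xs = refl
  cons (pos (suc _)) xs = refl
  cons (-[1+ _ ]) xs = refl

sum-tabulate : ∀ {n} (f : Fin n → ℕ) g → (∀ i → f i ≡ g (toℕ i)) → sum (tabulate f) ≡ ∑ n g
sum-tabulate {zero}  f g eq = refl
sum-tabulate {suc n} f g eq = trans (cong₂ _+_ (eq Fin.zero) (sum-tabulate (f ∘ Fin.suc) (g ∘ suc) (eq ∘ Fin.suc)))
  (sym (∑-head n g))

nnz≡changes : ∀ {n} {M : Matrix n} c →
  (∀ i j → M i j ≡ difference (c (toℕ i) (toℕ j)) (c (suc (toℕ i)) (toℕ j))) → nnz M ≡ changes n c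
nnz≡changes {n} {M} c entries = trans (cong sum (map-tabulate id (λ i → length (nonzeros (row M i)))))
  (sum-tabulate _ (λ i → ∑ n (change c i)) λ i → length-nonzeros (M i) (change c (toℕ i)) λ j →
    trans (cong (λ x → length (nonzeros (x ∷ []))) (entries i j)) (count (c (toℕ i) (toℕ j)) (c (suc (toℕ i)) (toℕ j))))
  where
  count : ∀ x y → length (nonzeros (difference x y ∷ [])) ≡ ι (x xor y)
  count false false = refl
  count false true  = refl
  count true  false = refl
  count true  true  = refl

-- The diamond ASM

odd : ℕ → Bool
odd zero    = false
odd (suc n) = not (odd n)

odd-+ : ∀ a b → odd (a + b) ≡ odd a xor odd b
odd-+ zero    b = refl
odd-+ (suc a) b rewrite odd-+ a b with odd a
... | false = refl
... | true  = not-involutive (odd b)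

odd-double : ∀ a → odd (a + a) ≡ false
odd-double a rewrite odd-+ a a with odd a
... | false = refl
... | true  = refl

≤ᵇ-true : ∀ {a b} → a ≤ b → (a ≤ᵇ b) ≡ true
≤ᵇ-true {a} {b} = dec-true (a ≤? b)

≤ᵇ-false : ∀ {a b} → b < a → (a ≤ᵇ b) ≡ false
≤ᵇ-false {a} {b} b<a = dec-false (a ≤? b) (<⇒≱ b<a)

-- The partial row sums of the diamond ASM D (1-based row I, first J entries): they are 0 up to the
-- left border of the diamond, 1 from its right border on, and alternate in between.
base : (m I J : ℕ) → Bool
base m I J = ((m + 2 ≤ᵇ I + J) ∧ (I ≤ᵇ J + m)) ∧ (((3 * m ≤ᵇ I + J) ∨ (I + m ≤ᵇ J)) ∨ odd (I + J))

module Base (m : ℕ) (odd-m : odd m ≡ true) where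

  private
    1≤m : 1 ≤ m
    1≤m = positive m odd-m
      where
      positive : ∀ m → odd m ≡ true → 1 ≤ m
      positive (suc m) _ = s≤s z≤n

  base-low : ∀ {I J} → I + J < m + 2 ⊎ J + m < I → base m I J ≡ false
  base-low {I} {J} (inj₁ p) rewrite ≤ᵇ-false p = refl
  base-low {I} {J} (inj₂ p) rewrite ≤ᵇ-false p with m + 2 ≤ᵇ I + J
  ... | false = refl
  ... | true  = refl

  base-high : ∀ {I J} → 1 ≤ I → I ≤ m + m → 3 * m ≤ I + J ⊎ I + m ≤ J → base m I J ≡ true
  base-high {I} {J} 1≤I I≤2m (inj₁ p)
    rewrite ≤ᵇ-true {m + 2} {I + J} (linear 0 (+-mono-≤ p (+-mono-≤ 1≤m 1≤m)) (solve (m ∷ I ∷ J ∷ [])))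
          | ≤ᵇ-true {I} {J + m} (linear 0 (+-mono-≤ p (+-mono-≤ I≤2m I≤2m)) (solve (m ∷ I ∷ J ∷ [])))
          | ≤ᵇ-true p = refl
  base-high {I} {J} 1≤I I≤2m (inj₂ p)
    rewrite ≤ᵇ-true {m + 2} {I + J} (linear 0 (+-mono-≤ p (+-mono-≤ 1≤I 1≤I)) (solve (m ∷ I ∷ J ∷ [])))
          | ≤ᵇ-true {I} {J + m} (linear (m + m) p (solve (m ∷ I ∷ J ∷ [])))
          | ≤ᵇ-true p with 3 * m ≤ᵇ I + J
  ... | false = refl
  ... | true  = refl

  base-alternating : ∀ {I J} → odd (I + J) ≡ true → m + 2 ≤ I + J → I ≤ J + m → base m I J ≡ true
  base-alternating {I} {J} o p q rewrite ≤ᵇ-true p | ≤ᵇ-true q | o = ∨-zeroʳ _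

  odd-3m : odd (3 * m) ≡ true
  odd-3m rewrite odd-+ m (m + (m + 0)) | odd-+ m (m + 0) | +-identityʳ m | odd-m = refl

  -- As `m` is odd, the constant values next to the left border and on the right border have the
  -- parity that continues the alternation. With this margin `base-step` can treat both ends of an
  -- entry alike.
  base-mid : ∀ {I J} → m + 1 ≤ I + J → I ≤ J + m + 1 → I + J ≤ 3 * m → J ≤ I + m → base m I J ≡ odd (I + J)
  base-mid {I} {J} p q p′ q′ with m + 2 ≤? I + J
  ... | no ¬p = trans (base-low {I} {J} (inj₁ (≰⇒> ¬p))) (sym (trans (cong odd I+J≡m+1) even))
    where
    I+J≡m+1 : I + J ≡ m + 1
    I+J≡m+1 = ≤-antisym (s≤s⁻¹ (≤-trans (≰⇒> ¬p) (≤-reflexive (+-suc m 1)))) p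
    even : odd (m + 1) ≡ false
    even rewrite odd-+ m 1 | odd-m = refl
  ... | yes p₂ with I ≤? J + m
  ...   | no ¬q = trans (base-low {I} {J} (inj₂ (≰⇒> ¬q))) (sym (trans (cong odd (trans (cong (_+ J) I≡J+m+1) (regroup J m))) even))
    where
    I≡J+m+1 : I ≡ J + m + 1
    I≡J+m+1 = ≤-antisym q (≤-trans (≤-reflexive (+-comm (J + m) 1)) (≰⇒> ¬q))
    regroup : ∀ J m → J + m + 1 + J ≡ (J + J) + (m + 1)
    regroup J m = solve (J ∷ m ∷ [])
    even : odd ((J + J) + (m + 1)) ≡ false
    even rewrite odd-+ (J + J) (m + 1) | odd-double J | odd-+ m 1 | odd-m = refl
  ...   | yes q₂ = byParity (odd (I + J)) refl
    where
    byParity : ∀ b → odd (I + J) ≡ b → base m I J ≡ b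
    byParity true  o = base-alternating o p₂ q₂
    byParity false o = interior (≤∧≢⇒< p′ I+J≢3m) (≤∧≢⇒< q′ J≢I+m)
      where
      I+J≢3m : I + J ≢ 3 * m
      I+J≢3m e = contradiction (trans (sym o) (trans (cong odd e) odd-3m)) λ ()
      J≢I+m : J ≢ I + m
      J≢I+m e = contradiction (trans (sym o) (trans (cong odd (trans (cong (I +_) e) (sym (+-assoc I I m)))) odd-sum)) λ ()
        where
        odd-sum : odd (I + I + m) ≡ true
        odd-sum rewrite odd-+ (I + I) m | odd-double I = odd-m
      interior : I + J < 3 * m → J < I + m → base m I J ≡ false
      interior r s rewrite ≤ᵇ-true p₂ | ≤ᵇ-true q₂ | o | ≤ᵇ-false r | ≤ᵇ-false s = refl

  base-odd : ∀ {I J} → 1 ≤ I → I ≤ m + m → J ≤ m → base m I J ≡ true → odd (I + J) ≡ true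
  base-odd {I} {J} 1≤I I≤2m J≤m b with m + 2 ≤? I + J
  ... | no ¬p = contradiction (trans (sym b) (base-low {I} {J} (inj₁ (≰⇒> ¬p)))) λ ()
  ... | yes p with I ≤? J + m
  ...   | no ¬q = contradiction (trans (sym b) (base-low {I} {J} (inj₂ (≰⇒> ¬q)))) λ ()
  ...   | yes q = trans (sym (base-mid {I} {J} (linear 1 p (solve (m ∷ I ∷ J ∷ []))) (linear 1 q (solve (m ∷ I ∷ J ∷ [])))
      (linear 0 (+-mono-≤ I≤2m J≤m) (solve (m ∷ I ∷ J ∷ []))) (linear I J≤m (solve (m ∷ I ∷ J ∷ []))))) b

  signPow-parity : ∀ e → signPow e ≡ difference (odd e) (not (odd e))
  signPow-parity zero          = refl
  signPow-parity (suc zero)    = refl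
  signPow-parity (suc (suc e)) = trans (signPow-parity e) (cong (λ b → difference b (not b)) (sym (not-involutive (odd e))))

  diamondEntry-outside : ∀ {I J} → (I + J < m + 2 ⊎ J + m < I) ⊎ (3 * m < I + J ⊎ I + m < J) →
    diamondEntry m I J ≡ pos 0
  diamondEntry-outside {I} {J} (inj₁ (inj₁ p)) rewrite ≤ᵇ-false p = refl
  diamondEntry-outside {I} {J} (inj₁ (inj₂ p))
    rewrite ≤ᵇ-false {I ∸ J} {m} (m+n≤o⇒m≤o∸n (suc m) (≤-trans (≤-reflexive (cong suc (+-comm m J))) p))
    with m + 2 ≤ᵇ I + J | I + J ≤ᵇ 3 * m
  ... | false | _     = refl
  ... | true  | false = refl
  ... | true  | true  = refl
  diamondEntry-outside {I} {J} (inj₂ (inj₁ p)) rewrite ≤ᵇ-false p with m + 2 ≤ᵇ I + J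
  ... | false = refl
  ... | true  = refl
  diamondEntry-outside {I} {J} (inj₂ (inj₂ p))
    rewrite ≤ᵇ-false {J ∸ I} {m} (m+n≤o⇒m≤o∸n (suc m) (≤-trans (≤-reflexive (cong suc (+-comm m I))) p))
    with m + 2 ≤ᵇ I + J | I + J ≤ᵇ 3 * m | I ∸ J ≤ᵇ m
  ... | false | _     | _     = refl
  ... | true  | false | _     = refl
  ... | true  | true  | false = refl
  ... | true  | true  | true  = refl

  diamondEntry-inside : ∀ {I J} → m + 2 ≤ I + J → I ≤ J + m → I + J ≤ 3 * m → J ≤ I + m →
    diamondEntry m I J ≡ difference (not (odd (I + J))) (odd (I + J))
  diamondEntry-inside {I} {J} p q p′ q′
    rewrite ≤ᵇ-true p | ≤ᵇ-true p′ | ≤ᵇ-true {I ∸ J} {m} (m≤n+o⇒m∸n≤o I J q) | ≤ᵇ-true {J ∸ I} {m} (m≤n+o⇒m∸n≤o J I q′)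
    = trans (signPow-parity (I + J ∸ (m + 2))) (cong₂ difference parity (cong not parity ⟨≡⟩ not-involutive _))
    where
    _⟨≡⟩_ = trans
    parity : odd (I + J ∸ (m + 2)) ≡ not (odd (I + J))
    parity = sym (trans (cong (not ∘ odd) (sym (m∸n+n≡m p))) (flip (I + J ∸ (m + 2))))
      where
      flip : ∀ e → not (odd (e + (m + 2))) ≡ odd e
      flip e rewrite odd-+ e (m + 2) | odd-+ m 2 | odd-m with odd e
      ... | false = refl
      ... | true  = refl

  base-step : ∀ {I J} → 1 ≤ I → I ≤ m + m → diamondEntry m I (suc J) ≡ difference (base m I J) (base m I (suc J))
  base-step {I} {J} 1≤I I≤2m with m + 2 ≤? I + suc J
  ... | no ¬p = trans (diamondEntry-outside {I} {suc J} (inj₁ (inj₁ (≰⇒> ¬p))))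
    (sym (cong₂ difference (base-low {I} {J} (inj₁ (<-trans (+-monoʳ-< I (n<1+n J)) (≰⇒> ¬p)))) (base-low {I} {suc J} (inj₁ (≰⇒> ¬p)))))
  ... | yes p with I ≤? suc J + m
  ...   | no ¬q = trans (diamondEntry-outside {I} {suc J} (inj₁ (inj₂ (≰⇒> ¬q))))
    (sym (cong₂ difference (base-low {I} {J} (inj₂ (<-trans (n<1+n (J + m)) (≰⇒> ¬q)))) (base-low {I} {suc J} (inj₂ (≰⇒> ¬q)))))
  ...   | yes q with I + suc J ≤? 3 * m
  ...     | no ¬p′ = trans (diamondEntry-outside {I} {suc J} (inj₂ (inj₁ (≰⇒> ¬p′))))
    (sym (cong₂ difference (base-high {I} {J} 1≤I I≤2m (inj₁ (s≤s⁻¹ (≤-trans (≰⇒> ¬p′) (≤-reflexive (+-suc I J))))))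
      (base-high {I} {suc J} 1≤I I≤2m (inj₁ (<⇒≤ (≰⇒> ¬p′))))))
  ...     | yes p′ with suc J ≤? I + m
  ...       | no ¬q′ = trans (diamondEntry-outside {I} {suc J} (inj₂ (inj₂ (≰⇒> ¬q′))))
    (sym (cong₂ difference (base-high {I} {J} 1≤I I≤2m (inj₂ (s≤s⁻¹ (≰⇒> ¬q′)))) (base-high {I} {suc J} 1≤I I≤2m (inj₂ (<⇒≤ (≰⇒> ¬q′))))))
  ...       | yes q′ = trans (diamondEntry-inside {I} {suc J} p q p′ q′) (sym (cong₂ difference
    (trans (base-mid {I} {J} (linear 0 p (solve (m ∷ I ∷ J ∷ []))) (linear 0 q (solve (m ∷ I ∷ J ∷ []))) (linear 1 p′ (solve (m ∷ I ∷ J ∷ []))) (<⇒≤ q′))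
      (sym (trans (cong (not ∘ odd) (+-suc I J)) (not-involutive _))))
    (base-mid {I} {suc J} (linear 1 p (solve (m ∷ I ∷ J ∷ []))) (linear 1 q (solve (m ∷ I ∷ J ∷ []))) p′ q′)))

  -- Rotation exchanges the left and the right border. In between, `I + J` and `I′ + J′` have an odd
  -- sum, hence opposite parities.
  base-rot : ∀ {I J I′ J′} → 1 ≤ I → I ≤ m + m → I + I′ ≡ suc (m + m) → J + J′ ≡ m + m →
    not (base m I′ J′) ≡ base m I J
  base-rot {I} {J} {I′} {J′} 1≤I I≤2m eI eJ with m + 2 ≤? I + J
  ... | no ¬p = trans (cong not (base-high 1≤I′ I′≤2m (inj₁ (linear 0
      (+-mono-≤ (≰⇒> ¬p) (+-mono-≤ (≤-reflexive (sym eI)) (≤-reflexive (sym eJ)))) (solve (m ∷ I ∷ J ∷ I′ ∷ J′ ∷ []))))))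
    (sym (base-low {I} {J} (inj₁ (≰⇒> ¬p))))
    where
    1≤I′ : 1 ≤ I′
    1≤I′ = linear 0 (+-mono-≤ I≤2m (≤-reflexive (sym eI))) (solve (m ∷ I ∷ I′ ∷ []))
    I′≤2m : I′ ≤ m + m
    I′≤2m = linear 0 (+-mono-≤ 1≤I (≤-reflexive eI)) (solve (m ∷ I ∷ I′ ∷ []))
  ... | yes p with I ≤? J + m
  ...   | no ¬q = trans (cong not (base-high 1≤I′ I′≤2m (inj₂ (linear 0
      (+-mono-≤ (≰⇒> ¬q) (+-mono-≤ (≤-reflexive eI) (≤-reflexive (sym eJ)))) (solve (m ∷ I ∷ J ∷ I′ ∷ J′ ∷ []))))))
    (sym (base-low {I} {J} (inj₂ (≰⇒> ¬q))))
    where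
    1≤I′ : 1 ≤ I′
    1≤I′ = linear 0 (+-mono-≤ I≤2m (≤-reflexive (sym eI))) (solve (m ∷ I ∷ I′ ∷ []))
    I′≤2m : I′ ≤ m + m
    I′≤2m = linear 0 (+-mono-≤ 1≤I (≤-reflexive eI)) (solve (m ∷ I ∷ I′ ∷ []))
  ...   | yes q with 3 * m ≤? I + J
  ...     | yes p′ = trans (cong not (base-low {I′} {J′} (inj₁ (linear 0
      (+-mono-≤ p′ (+-mono-≤ (≤-reflexive eI) (≤-reflexive eJ))) (solve (m ∷ I ∷ J ∷ I′ ∷ J′ ∷ []))))))
    (sym (base-high {I} {J} 1≤I I≤2m (inj₁ p′)))
  ...     | no ¬p′ with I + m ≤? J
  ...       | yes q′ = trans (cong not (base-low {I′} {J′} (inj₂ (linear 0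
      (+-mono-≤ q′ (+-mono-≤ (≤-reflexive (sym eI)) (≤-reflexive eJ))) (solve (m ∷ I ∷ J ∷ I′ ∷ J′ ∷ []))))))
    (sym (base-high {I} {J} 1≤I I≤2m (inj₂ q′)))
  ...       | no ¬q′ = trans (cong not (base-mid {I′} {J′}
      (linear 1 (+-mono-≤ (≰⇒> ¬p′) (+-mono-≤ (≤-reflexive (sym eI)) (≤-reflexive (sym eJ)))) (solve (m ∷ I ∷ J ∷ I′ ∷ J′ ∷ [])))
      (linear 1 (+-mono-≤ (≰⇒> ¬q′) (+-mono-≤ (≤-reflexive eI) (≤-reflexive (sym eJ)))) (solve (m ∷ I ∷ J ∷ I′ ∷ J′ ∷ [])))
      (linear 1 (+-mono-≤ p (+-mono-≤ (≤-reflexive eI) (≤-reflexive eJ))) (solve (m ∷ I ∷ J ∷ I′ ∷ J′ ∷ [])))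
      (linear 1 (+-mono-≤ q (+-mono-≤ (≤-reflexive (sym eI)) (≤-reflexive eJ))) (solve (m ∷ I ∷ J ∷ I′ ∷ J′ ∷ [])))))
    (trans (parity (I + J) (I′ + J′) complement)
    (sym (base-mid {I} {J} (linear 1 p (solve (m ∷ I ∷ J ∷ []))) (linear 1 q (solve (m ∷ I ∷ J ∷ [])))
      (<⇒≤ (≰⇒> ¬p′)) (<⇒≤ (≰⇒> ¬q′)))))
    where
    complement : (I + J) + (I′ + J′) ≡ suc ((m + m) + (m + m))
    complement = trans (regroup I J I′ J′) (cong₂ _+_ eI eJ)
      where
      regroup : ∀ a b c d → (a + b) + (c + d) ≡ (a + c) + (b + d)
      regroup a b c d = solve (a ∷ b ∷ c ∷ d ∷ [])
    parity : ∀ a b → a + b ≡ suc ((m + m) + (m + m)) → not (odd b) ≡ odd a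
    parity a b e with odd a | odd b | trans (sym (odd-+ a b)) (trans (cong odd e) (cong not (odd-double (m + m))))
    ... | true  | false | _ = refl
    ... | false | true  | _ = refl

-- The hollowed-diamond ASM

even-half : ∀ e → odd e ≡ false → ∃[ t ] e ≡ t + t
even-half zero          _ = 0 , refl
even-half (suc (suc e)) o with even-half e (trans (sym (not-involutive (odd e))) o)
... | t , refl = suc t , cong suc (sym (+-suc t t))

-- The cells J = k + 2t, I ∈ {J, J + 1} with 1 ≤ t ≤ k: there the deletion of the 2 × 2 blocks
-- flips the partial row sum of D.
Hollow : (k I J : ℕ) → Set
Hollow k I J = (k + 2 ≤ J × J ≤ 3 * k) × (odd (J + k) ≡ false × (I ≡ J ⊎ I ≡ suc J))

hollow? : ∀ k I J → Dec (Hollow k I J)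
hollow? k I J = ((k + 2 ≤? J) ×-dec (J ≤? 3 * k)) ×-dec ((odd (J + k) Bool.≟ false) ×-dec ((I ≟ J) ⊎-dec (I ≟ suc J)))

star : (k I J : ℕ) → Bool
star k I J = base (suc (k + k)) I J xor does (hollow? k I J)

module Star (k : ℕ) where

  odd-m : odd (suc (k + k)) ≡ true
  odd-m = cong not (odd-double k)

  open Base (suc (k + k)) odd-m

  star-on : ∀ {I J} → Hollow k I J → star k I J ≡ not (base (suc (k + k)) I J)
  star-on {I} {J} h rewrite dec-true (hollow? k I J) h with base (suc (k + k)) I J
  ... | false = refl
  ... | true  = refl

  star-off : ∀ {I J} → ¬ Hollow k I J → star k I J ≡ base (suc (k + k)) I J
  star-off {I} {J} h rewrite dec-false (hollow? k I J) h with base (suc (k + k)) I J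
  ... | false = refl
  ... | true  = refl

  hollow-range : ∀ {I J} → Hollow k I J → J ≤ I × I ≤ suc J
  hollow-range (_ , _ , inj₁ refl) = ≤-refl , n≤1+n _
  hollow-range (_ , _ , inj₂ refl) = n≤1+n _ , ≤-refl

  -- The blocks lie inside the diamond, where partial sums alternate; the two lemmas that follow
  -- treat the cells on either side.
  hollow-base : ∀ {I J} → Hollow k I J → base (suc (k + k)) I J ≡ odd (I + J)
  hollow-base {I} {J} h@((l , u) , _) = base-mid {I} {J}
    (linear 2 (+-mono-≤ (+-mono-≤ l l) J≤I) (solve (k ∷ I ∷ J ∷ [])))
    (linear (suc (k + k)) I≤1+J (solve (k ∷ I ∷ J ∷ [])))
    (linear 2 (+-mono-≤ I≤1+J (+-mono-≤ u u)) (solve (k ∷ I ∷ J ∷ [])))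
    (linear (suc (k + k)) J≤I (solve (k ∷ I ∷ J ∷ [])))
    where
    J≤I = proj₁ (hollow-range h)
    I≤1+J = proj₂ (hollow-range h)

  hollow-base-next : ∀ {I J} → Hollow k I J → base (suc (k + k)) I (suc J) ≡ odd (I + suc J)
  hollow-base-next {I} {J} h@((l , u) , _) = base-mid {I} {suc J}
    (linear 3 (+-mono-≤ (+-mono-≤ l l) J≤I) (solve (k ∷ I ∷ J ∷ [])))
    (linear (suc (suc (k + k))) I≤1+J (solve (k ∷ I ∷ J ∷ [])))
    (linear 1 (+-mono-≤ I≤1+J (+-mono-≤ u u)) (solve (k ∷ I ∷ J ∷ [])))
    (linear (k + k) J≤I (solve (k ∷ I ∷ J ∷ [])))
    where
    J≤I = proj₁ (hollow-range h)
    I≤1+J = proj₂ (hollow-range h)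

  hollow-base-previous : ∀ {I J} → Hollow k I (suc J) → base (suc (k + k)) I J ≡ odd (I + J)
  hollow-base-previous {I} {J} h@((l , u) , _) = base-mid {I} {J}
    (linear 1 (+-mono-≤ (+-mono-≤ l l) J≤I) (solve (k ∷ I ∷ J ∷ [])))
    (linear (k + k) I≤1+J (solve (k ∷ I ∷ J ∷ [])))
    (linear 3 (+-mono-≤ I≤1+J (+-mono-≤ u u)) (solve (k ∷ I ∷ J ∷ [])))
    (linear (suc (suc (k + k))) J≤I (solve (k ∷ I ∷ J ∷ [])))
    where
    J≤I = proj₁ (hollow-range h)
    I≤1+J = proj₂ (hollow-range h)

  hollow-alternate : ∀ {I J} → Hollow k I J → ¬ Hollow k I (suc J)
  hollow-alternate {I} {J} (_ , e , _) (_ , e′ , _) with odd (J + k)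
  hollow-alternate (_ , refl , _) (_ , () , _) | false

  hollow-block : ∀ {I J} t → t < k → J ≡ k + 2 * suc t → I ≡ k + 2 * suc t ⊎ I ≡ k + 2 * suc t + 1 → Hollow k I J
  hollow-block {I} t t<k refl I≡ =
      (linear (t + t) (≤-refl {0}) (solve (k ∷ t ∷ [])) , linear 0 (+-mono-≤ t<k t<k) (solve (k ∷ t ∷ [])))
    , trans (cong odd (regroup k t)) (odd-double (k + suc t))
    , [ inj₁ , (λ e → inj₂ (trans e (+-comm _ 1))) ]′ I≡
    where
    regroup : ∀ k t → k + 2 * suc t + k ≡ (k + suc t) + (k + suc t)
    regroup k t = solve (k ∷ t ∷ [])

  block-hollow : ∀ {I J} → Hollow k I J → ∃[ t ] t < k × J ≡ k + 2 * suc t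
  block-hollow {I} {J} ((l , u) , e , _) = t , t<k , J≡
    where
    half : ∃[ t ] J ∸ (k + 2) ≡ t + t
    half = even-half (J ∸ (k + 2)) (trans (sym (parity (J ∸ (k + 2)))) (trans (cong (λ j → odd (j + k)) (m∸n+n≡m l)) e))
      where
      regroup : ∀ k e → e + (k + 2) + k ≡ e + (suc k + suc k)
      regroup k e = solve (k ∷ e ∷ [])
      parity : ∀ e → odd (e + (k + 2) + k) ≡ odd e
      parity e rewrite regroup k e | odd-+ e (suc k + suc k) | odd-double (suc k) with odd e
      ... | false = refl
      ... | true  = refl
    t : ℕ
    t = proj₁ half
    J≡ : J ≡ k + 2 * suc t
    J≡ = trans (sym (m∸n+n≡m l)) (trans (cong (_+ (k + 2)) (proj₂ half)) (regroup k t))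
      where
      regroup : ∀ k t → t + t + (k + 2) ≡ k + 2 * suc t
      regroup k t = solve (k ∷ t ∷ [])
    t<k : t < k
    t<k with suc t ≤? k
    ... | yes p = p
    ... | no ¬p = impossible 1 (≤-trans (+-mono-≤ (+-mono-≤ (≰⇒> ¬p) (≰⇒> ¬p)) (≤-reflexive (sym J≡))) (+-monoʳ-≤ (suc t + suc t) u)) (eq k t)
      where
      eq : ∀ k t → 1 + 1 + (suc t + suc t + 3 * k) ≡ suc k + suc k + (k + 2 * suc t)
      eq k t = solve (k ∷ t ∷ [])

  private
    inBlock : ℕ → ℕ → ℕ → Bool
    inBlock I J t = inPair k t I ∧ inPair k t J

    T-inPair⁻ : ∀ t x → T (inPair k t x) → x ≡ k + 2 * t ⊎ x ≡ k + 2 * t + 1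
    T-inPair⁻ t x p = [ (λ q → inj₁ (≡ᵇ⇒≡ x (k + 2 * t) q)) , (λ q → inj₂ (≡ᵇ⇒≡ x (k + 2 * t + 1) q)) ]′
      (Equivalence.to (T-∨ {x ≡ᵇ (k + 2 * t)} {x ≡ᵇ (k + 2 * t + 1)}) p)

    T-inPair⁺ : ∀ t x → x ≡ k + 2 * t ⊎ x ≡ k + 2 * t + 1 → T (inPair k t x)
    T-inPair⁺ t x e = Equivalence.from (T-∨ {x ≡ᵇ (k + 2 * t)} {x ≡ᵇ (k + 2 * t + 1)})
      ([ (λ q → inj₁ (≡⇒≡ᵇ x (k + 2 * t) q)) , (λ q → inj₂ (≡⇒≡ᵇ x (k + 2 * t + 1) q)) ]′ e)

  -- The entry in column `suc J` lies between the partial sums `J` and `suc J`. The flipped one is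
  -- the former in the right column of a block and the latter in the left column.
  hollowed⁻ : ∀ {I J} → hollowed k I (suc J) ≡ true → Hollow k I J ⊎ Hollow k I (suc J)
  hollowed⁻ {I} {J} h = locate (Any.applyUpTo⁻ id (Any.map⁻ (Any.any⁻ (inBlock I (suc J)) (map suc (upTo k)) (Equivalence.from T-≡ h))))
    where
    locate : ∃[ t ] t < k × T (inBlock I (suc J) (suc t)) → Hollow k I J ⊎ Hollow k I (suc J)
    locate (t , t<k , p) = [ (λ e → inj₂ (block e)) , (λ e → inj₁ (block (suc-injective (trans e (+-comm (k + 2 * suc t) 1))))) ]′
        (T-inPair⁻ (suc t) (suc J) (proj₂ both-in))
      where
      both-in : T (inPair k (suc t) I) × T (inPair k (suc t) (suc J))
      both-in = Equivalence.to (T-∧ {inPair k (suc t) I} {inPair k (suc t) (suc J)}) p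
      block : ∀ {J} → J ≡ k + 2 * suc t → Hollow k I J
      block e = hollow-block t t<k e (T-inPair⁻ (suc t) I (proj₁ both-in))

  hollowed⁺ : ∀ {I J J′} → Hollow k I J → J′ ≡ J ⊎ J′ ≡ suc J → hollowed k I J′ ≡ true
  hollowed⁺ {I} {J} {J′} h@(_ , _ , I≡) J′≡ = place (block-hollow h)
    where
    place : ∃[ t ] t < k × J ≡ k + 2 * suc t → hollowed k I J′ ≡ true
    place (t , t<k , J≡) = Equivalence.to T-≡ (Any.any⁺ (inBlock I J′) (Any.map⁺ (Any.applyUpTo⁺ id inside t<k)))
      where
      shift : ∀ {x} → x ≡ J ⊎ x ≡ suc J → x ≡ k + 2 * suc t ⊎ x ≡ k + 2 * suc t + 1
      shift (inj₁ e) = inj₁ (trans e J≡)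
      shift (inj₂ e) = inj₂ (trans e (trans (cong suc J≡) (+-comm 1 (k + 2 * suc t))))
      inside : T (inBlock I J′ (suc t))
      inside = Equivalence.from (T-∧ {inPair k (suc t) I} {inPair k (suc t) J′})
        (T-inPair⁺ (suc t) I (shift I≡) , T-inPair⁺ (suc t) J′ (shift J′≡))

  entry : ℕ → ℕ → ℤ
  entry I J = if hollowed k I J then pos 0 else diamondEntry (suc (k + k)) I J

  entry-hollowed : ∀ {I J} → hollowed k I J ≡ true → entry I J ≡ pos 0
  entry-hollowed e rewrite e = refl

  private
    constant : ∀ {x y} → x ≡ y → pos 0 ≡ difference x y
    constant {false} refl = refl
    constant {true}  refl = refl

  -- Flipping exactly one end of a nonzero step of D makes the ends equal and the entry 0; both ends
  -- are never flipped.
  entry-step : ∀ {I J} → 1 ≤ I → I ≤ suc (k + k) + suc (k + k) → entry I (suc J) ≡ difference (star k I J) (star k I (suc J))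
  entry-step {I} {J} 1≤I I≤n = byCases (hollow? k I J) (hollow? k I (suc J))
    where
    open ≡-Reasoning
    byCases : Dec (Hollow k I J) → Dec (Hollow k I (suc J)) → entry I (suc J) ≡ difference (star k I J) (star k I (suc J))
    byCases (yes h) (yes h′) = contradiction h′ (hollow-alternate h)
    byCases (yes h) (no ¬h′) = trans (entry-hollowed {I} {suc J} (hollowed⁺ h (inj₂ refl))) (constant (begin
      star k I J                         ≡⟨ star-on h ⟩
      not (base (suc (k + k)) I J)       ≡⟨ cong not (hollow-base h) ⟩
      odd (suc (I + J))                  ≡⟨ cong odd (+-suc I J) ⟨
      odd (I + suc J)                    ≡⟨ hollow-base-next h ⟨
      base (suc (k + k)) I (suc J)       ≡⟨ star-off ¬h′ ⟨
      star k I (suc J)                   ∎))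
    byCases (no ¬h) (yes h′) = trans (entry-hollowed {I} {suc J} (hollowed⁺ h′ (inj₁ refl))) (constant (begin
      star k I J                         ≡⟨ star-off ¬h ⟩
      base (suc (k + k)) I J             ≡⟨ hollow-base-previous h′ ⟩
      odd (I + J)                        ≡⟨ not-involutive _ ⟨
      not (odd (suc (I + J)))            ≡⟨ cong (not ∘ odd) (+-suc I J) ⟨
      not (odd (I + suc J))              ≡⟨ cong not (hollow-base h′) ⟨
      not (base (suc (k + k)) I (suc J)) ≡⟨ star-on h′ ⟨
      star k I (suc J)                   ∎))
    byCases (no ¬h) (no ¬h′) = trans (untouched _ refl) (trans (base-step {I} {J} 1≤I I≤n)
      (sym (cong₂ difference (star-off ¬h) (star-off ¬h′))))
      where
      untouched : ∀ b → hollowed k I (suc J) ≡ b → entry I (suc J) ≡ diamondEntry (suc (k + k)) I (suc J)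
      untouched false e rewrite e = refl
      untouched true  e = contradiction (hollowed⁻ {I} {J} e) [ ¬h , ¬h′ ]′

  entry-sym : ∀ I J → entry I J ≡ entry J I
  entry-sym I J = cong₂ (λ b x → if b then pos 0 else x) (any-cong (map suc (upTo k))) diamond-sym
    where
    any-cong : ∀ ts → any (inBlock I J) ts ≡ any (inBlock J I) ts
    any-cong []       = refl
    any-cong (t ∷ ts) = cong₂ _∨_ (∧-comm (inPair k t I) (inPair k t J)) (any-cong ts)
    diamond-sym : diamondEntry (suc (k + k)) I J ≡ diamondEntry (suc (k + k)) J I
    diamond-sym rewrite +-comm J I | ∧-comm (J ∸ I ≤ᵇ suc (k + k)) (I ∸ J ≤ᵇ suc (k + k)) = refl

  -- The diagonal meets the diamond in the positions from k + 2 to 3k + 1, and the blocks pair these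
  -- up. The parity of `J + k` tells whether `suc J` is the first or the second of its pair.
  entry-diag : ∀ J → entry (suc J) (suc J) ≡ pos 0
  entry-diag J with hollowed k (suc J) (suc J) in e
  ... | true  = refl
  ... | false with suc (k + k) + 2 ≤? suc J + suc J
  ...   | no ¬p = diamondEntry-outside {suc J} {suc J} (inj₁ (inj₁ (≰⇒> ¬p)))
  ...   | yes p with suc J + suc J ≤? 3 * suc (k + k)
  ...     | no ¬p′ = diamondEntry-outside {suc J} {suc J} (inj₂ (inj₁ (≰⇒> ¬p′)))
  ...     | yes p′ = contradiction (trans (sym e) (covered (odd (J + k)) refl)) λ ()
    where
    k+2≤1+J : k + 2 ≤ suc J
    k+2≤1+J = halve-≤ (linear 0 p (solve (k ∷ J ∷ [])))
    J≤3k : J ≤ 3 * k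
    J≤3k = halve-≤ (linear 0 p′ (solve (k ∷ J ∷ [])))
    covered : ∀ b → odd (J + k) ≡ b → hollowed k (suc J) (suc J) ≡ true
    covered false o with k + 2 ≤? J
    ... | yes l = hollowed⁺ {J = J} ((l , J≤3k) , o , inj₂ refl) (inj₂ refl)
    ... | no ¬l = contradiction (trans (sym o) (trans (cong (λ j → odd (j + k)) (suc-injective
                    (trans (≤-antisym (≰⇒> ¬l) k+2≤1+J) (+-comm k 2)))) (cong not (odd-double k)))) λ ()
    covered true o with suc J ≤? 3 * k
    ... | yes u = hollowed⁺ {J = suc J} ((k+2≤1+J , u) , cong not o , inj₁ refl) (inj₁ refl)
    ... | no ¬u = contradiction (trans (sym o) (trans (cong (λ j → odd (j + k)) (≤-antisym J≤3k (s≤s⁻¹ (≰⇒> ¬u))))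
                    (trans (cong odd (regroup k)) (odd-double (k + k))))) λ ()
      where
      regroup : ∀ k → 3 * k + k ≡ (k + k) + (k + k)
      regroup k = solve (k ∷ [])

  star-start : ∀ {I} → star k I 0 ≡ false
  star-start {I} = trans (star-off {I} {0} λ ((l , _) , _) → contradiction (≤-trans (m≤n+m 2 k) l) λ ()) low
    where
    low : base (suc (k + k)) I 0 ≡ false
    low with suc (k + k) + 2 ≤? I + 0
    ... | no ¬p = base-low {I} {0} (inj₁ (≰⇒> ¬p))
    ... | yes p = base-low {I} {0} (inj₂ (linear 1 p (solve (k ∷ I ∷ []))))

  star-end : ∀ {I} → 1 ≤ I → I ≤ suc (k + k) + suc (k + k) → star k I (suc (k + k) + suc (k + k)) ≡ true
  star-end {I} 1≤I I≤n = trans (star-off {I} {suc (k + k) + suc (k + k)} λ ((_ , u) , _) → impossible (suc k) u (eq k)) high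
    where
    eq : ∀ k → 1 + suc k + 3 * k ≡ suc (k + k) + suc (k + k)
    eq k = solve (k ∷ [])
    high : base (suc (k + k)) I (suc (k + k) + suc (k + k)) ≡ true
    high with I ≤? suc (k + k)
    ... | yes p = base-high {I} {suc (k + k) + suc (k + k)} 1≤I I≤n (inj₂ (+-monoˡ-≤ (suc (k + k)) p))
    ... | no ¬p = base-high {I} {suc (k + k) + suc (k + k)} 1≤I I≤n (inj₁ (linear 1 (≰⇒> ¬p) (solve (k ∷ I ∷ []))))

-- The indices are exchanged because `star` gives partial row sums, with rows counted from 1.
diamondSums : ℕ → ℕ → ℕ → Bool
diamondSums k i j = star k (suc j) i

-- Rotation symmetry, loss and shape of the hollowed diamond

module Extremal (k : ℕ) where

  open Star k
  open Base (suc (k + k)) odd-m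

  private
    m n : ℕ
    m = suc (k + k)
    n = m + m

  hollow-rot : ∀ {I J I′ J′} → I + I′ ≡ suc (suc (k + k) + suc (k + k)) → J + J′ ≡ suc (k + k) + suc (k + k) →
    Hollow k I J → Hollow k I′ J′
  hollow-rot {I} {J} {I′} {J′} eI eJ ((l , u) , e , I≡) =
      ( linear 0 (+-mono-≤ u (≤-reflexive (sym eJ))) (solve (k ∷ J ∷ J′ ∷ []))
      , linear 0 (+-mono-≤ l (≤-reflexive eJ)) (solve (k ∷ J ∷ J′ ∷ [])))
    , trans (parity (J + k) (J′ + k) (trans (regroup J J′ k) (trans (cong (_+ (k + k)) eJ) (regroup′ k)))) e
    , mirror I≡
    where
    regroup : ∀ J J′ k → (J + k) + (J′ + k) ≡ J + J′ + (k + k)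
    regroup J J′ k = solve (J ∷ J′ ∷ k ∷ [])
    regroup′ : ∀ k → suc (k + k) + suc (k + k) + (k + k) ≡ (suc (k + k) + k) + (suc (k + k) + k)
    regroup′ k = solve (k ∷ [])
    parity : ∀ a b → a + b ≡ (suc (k + k) + k) + (suc (k + k) + k) → odd b ≡ odd a
    parity a b s with odd a | odd b | trans (sym (odd-+ a b)) (trans (cong odd s) (odd-double (suc (k + k) + k)))
    ... | true  | true  | _ = refl
    ... | false | false | _ = refl
    mirror : I ≡ J ⊎ I ≡ suc J → I′ ≡ J′ ⊎ I′ ≡ suc J′
    mirror (inj₁ refl) = inj₂ (+-cancelˡ-≡ J _ _ (trans eI (trans (cong suc (sym eJ)) (sym (+-suc J J′)))))
    mirror (inj₂ refl) = inj₁ (+-cancelˡ-≡ J _ _ (trans (suc-injective eI) (sym eJ)))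

  star-rot : ∀ {I J I′ J′} → 1 ≤ I → I ≤ n → I + I′ ≡ suc n → J + J′ ≡ n → not (star k I′ J′) ≡ star k I J
  star-rot {I} {J} {I′} {J′} 1≤I I≤n eI eJ = byCases (hollow? k I J)
    where
    byCases : Dec (Hollow k I J) → not (star k I′ J′) ≡ star k I J
    byCases (yes h) = trans (cong not (star-on (hollow-rot eI eJ h)))
      (trans (cong not (base-rot {I} {J} 1≤I I≤n eI eJ)) (sym (star-on h)))
    byCases (no ¬h) = trans (cong not (star-off (¬h ∘ hollow-rot (trans (+-comm I′ I) eI) (trans (+-comm J′ J) eJ))))
      (trans (base-rot {I} {J} 1≤I I≤n eI eJ) (sym (star-off ¬h)))

  rot-diamondSums : ∀ i j → i ≤ n → j < n → rot n (diamondSums k) i j ≡ diamondSums k i j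
  rot-diamondSums i j i≤n j<n = star-rot (s≤s z≤n) j<n
    (cong suc (trans (cong (j +_) (sym (∸-suc-< j<n))) (m+[n∸m]≡n (<⇒≤ j<n)))) (m+[n∸m]≡n i≤n)

  -- In the left half the 1s of D occur at odd `I + J` only, so two consecutive ones require a
  -- flipped cell. A flip at `I = suc J` yields 0, so it must be one at `I = J`.
  survivor : ∀ {I i} → 1 ≤ I → I ≤ n → suc i ≤ m → star k I i ∧ star k I (suc i) ≡ true →
    (I ≡ suc i × odd (suc i + k) ≡ false × k + 2 ≤ suc i) ⊎ (I ≡ i × odd (i + k) ≡ false × k + 2 ≤ i)
  survivor {I} {i} 1≤I I≤n i<m s = byCases (hollow? k I i) (hollow? k I (suc i))
    where
    ∧-left : ∀ {a b} → a ∧ b ≡ true → a ≡ true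
    ∧-left {true} _ = refl
    ∧-right : ∀ {a b} → a ∧ b ≡ true → b ≡ true
    ∧-right {true} e = e
    flipped : ∀ J → Hollow k (suc J) J → star k (suc J) J ≢ true
    flipped J h e = contradiction (trans (sym e) (trans (star-on h) (cong not (trans (hollow-base h)
      (cong not (odd-double J)))))) λ ()
    byCases : Dec (Hollow k I i) → Dec (Hollow k I (suc i)) →
      (I ≡ suc i × odd (suc i + k) ≡ false × k + 2 ≤ suc i) ⊎ (I ≡ i × odd (i + k) ≡ false × k + 2 ≤ i)
    byCases (yes ((l , _) , o , inj₁ refl)) _ = inj₂ (refl , o , l)
    byCases (yes h@(_ , _ , inj₂ refl)) _ = contradiction (∧-left s) (flipped i h)
    byCases (no _) (yes ((l , _) , o , inj₁ refl)) = inj₁ (refl , o , l)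
    byCases (no _) (yes h@(_ , _ , inj₂ refl)) = contradiction (∧-right {star k I i} s) (flipped (suc i) h)
    byCases (no ¬h) (no ¬h′) = contradiction
      (base-odd 1≤I I≤n i<m (trans (sym (star-off ¬h′)) (∧-right {star k I i} s)))
      (λ o → contradiction (trans (sym (cong not (base-odd 1≤I I≤n (<⇒≤ i<m) (trans (sym (star-off ¬h)) (∧-left s)))))
        (trans (cong odd (sym (+-suc I i))) o)) λ ())

  private
    survives : ∀ {i j} → i < m → j < n → both (diamondSums k) i j ≢ 0 →
      (suc j ≡ suc i × odd (suc i + k) ≡ false × k + 2 ≤ suc i) ⊎ (suc j ≡ i × odd (i + k) ≡ false × k + 2 ≤ i)
    survives {i} {j} i<m j<n b = survivor (s≤s z≤n) j<n i<m (nonzero b)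
      where
      nonzero : ∀ {x} → ι x ≢ 0 → x ≡ true
      nonzero {true}  _ = refl
      nonzero {false} b = contradiction refl b

    decide : ∀ {x} → ¬ (x ≢ 0) → x ≡ 0
    decide {zero}  _ = refl
    decide {suc _} b = contradiction (λ ()) b

    row-none : ∀ i → i < suc k → ∑ n (both (diamondSums k) i) ≡ 0
    row-none i (s≤s i≤k) = ∑-all-zero n _ λ j j<n → decide λ b → early j (survives (s≤s (≤-trans i≤k (m≤m+n k k))) j<n b)
      where
      early : ∀ j → ¬ ((suc j ≡ suc i × odd (suc i + k) ≡ false × k + 2 ≤ suc i) ⊎ (suc j ≡ i × odd (i + k) ≡ false × k + 2 ≤ i))
      early j (inj₁ (_ , _ , l)) = impossible 0 (+-mono-≤ l i≤k) (solve (k ∷ i ∷ []))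
      early j (inj₂ (_ , _ , l)) = impossible 1 (+-mono-≤ l i≤k) (solve (k ∷ i ∷ []))

    row-one : ∀ i → i < m → ∑ n (both (diamondSums k) i) ≤ 1
    row-one i i<m = byParity (odd (i + k)) refl
      where
      byParity : ∀ b → odd (i + k) ≡ b → ∑ n (both (diamondSums k) i) ≤ 1
      -- The parity of `i + k` decides where the single survivor may lie: in column `i` here, in
      -- column `i - 1` in the other case.
      byParity true  o = ∑-single n (both (diamondSums k) i) i 1 (ι≤1 _) λ j j<n j≢i →
          decide λ b → j≢i (here j (survives i<m j<n b))
        where
        here : ∀ j → (suc j ≡ suc i × odd (suc i + k) ≡ false × k + 2 ≤ suc i) ⊎ (suc j ≡ i × odd (i + k) ≡ false × k + 2 ≤ i) → j ≡ i
        here j (inj₁ (e , _ , _)) = suc-injective e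
        here j (inj₂ (_ , e , _)) = contradiction (trans (sym o) e) λ ()
      byParity false o = ∑-single n (both (diamondSums k) i) (i ∸ 1) 1 (ι≤1 _) λ j j<n j≢i →
          decide λ b → j≢i (here j (survives i<m j<n b))
        where
        here : ∀ j → (suc j ≡ suc i × odd (suc i + k) ≡ false × k + 2 ≤ suc i) ⊎ (suc j ≡ i × odd (i + k) ≡ false × k + 2 ≤ i) → j ≡ i ∸ 1
        here j (inj₁ (_ , e , _)) = contradiction (trans (sym e) (cong not o)) λ ()
        here j (inj₂ (e , _ , _)) = cong (_∸ 1) e

  loss-diamondSums : loss m n (diamondSums k) ≤ k
  loss-diamondSums = begin
    loss m n (diamondSums k)                     ≡⟨ ∑-split (suc k) k alive ⟩
    ∑ (suc k) alive + ∑ k (λ i → alive (suc k + i))  ≡⟨ cong (_+ ∑ k (λ i → alive (suc k + i))) (∑-all-zero (suc k) alive row-none) ⟩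
    ∑ k (λ i → alive (suc k + i))                  ≤⟨ ∑-mono k (λ i i<k → row-one (suc k + i) (s≤s (+-monoʳ-< k i<k))) ⟩
    ∑ k (λ _ → 1)                                ≡⟨ trans (∑-const k 1) (*-identityʳ k) ⟩
    k ∎
    where
    open ≤-Reasoning
    alive : ℕ → ℕ
    alive i = ∑ n (both (diamondSums k) i)

  star-alternating : ∀ {I J} → I < J ⊎ suc J < I → odd (I + J) ≡ true → suc (k + k) + 2 ≤ I + J → I ≤ J + suc (k + k) → star k I J ≡ true
  star-alternating {I} {J} away o p q = trans (star-off (off away)) (base-alternating o p q)
    where
    off : I < J ⊎ suc J < I → ¬ Hollow k I J
    off (inj₁ I<J) h = <⇒≱ I<J (proj₁ (hollow-range h))
    off (inj₂ J<I) h = <⇒≱ J<I (proj₂ (hollow-range h))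

  star-low : ∀ {I J} → I < J ⊎ suc J < I → I + J < suc (k + k) + 2 ⊎ J + suc (k + k) < I → star k I J ≡ false
  star-low {I} {J} away p = trans (star-off (off away)) (base-low {I} {J} p)
    where
    off : I < J ⊎ suc J < I → ¬ Hollow k I J
    off (inj₁ I<J) h = <⇒≱ I<J (proj₁ (hollow-range h))
    off (inj₂ J<I) h = <⇒≱ J<I (proj₂ (hollow-range h))

  -- Away from the diagonal the 1s fill every other place between the borders of the diamond. A
  -- position between them has a 1 on one side, chosen by parity; beyond a border there are none.
  shape : Shaped (k + k) (diamondSums k)
  shape = record { left = left ; right = right }
    where
    left : ∀ {i J} → i ≤ k + k → J < i → PinnedLeft (diamondSums k (suc i)) J
    left {i} {zero} i≤r J<i = empty λ _ ()
    left {i} {suc J} i≤r J<i with suc (k + k) + 2 ≤? suc J + suc i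
    ... | no ¬p = empty λ j j<J → star-low {suc j} {suc i} (inj₁ (s≤s (≤-trans j<J (<⇒≤ J<i))))
                    (inj₁ (≤-trans (s≤s (+-monoˡ-≤ (suc i) j<J)) (≰⇒> ¬p)))
    ... | yes p = byParity (odd (suc J + suc i)) refl
      where
      byParity : ∀ b → odd (suc J + suc i) ≡ b → PinnedLeft (diamondSums k (suc i)) (suc J)
      byParity true  o = after J refl (star-alternating {suc J} {suc i} (inj₁ (m≤n⇒m≤1+n J<i)) o p
        (linear (suc (suc (suc (k + k)))) J<i (solve (k ∷ i ∷ J ∷ []))))
      byParity false o = before (star-alternating {suc (suc J)} {suc i} (inj₁ (s≤s J<i)) (cong not o) (m≤n⇒m≤1+n p)
        (linear (suc (suc (k + k))) J<i (solve (k ∷ i ∷ J ∷ []))))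
    right : ∀ {i J} → i < k + k → suc (k + k) < J → J ≤ n → PinnedRight n (diamondSums k (suc i)) J
    right {i} {suc J} i<r (s≤s m≤J) J≤n with suc (k + k) + suc i ≤? suc J
    ... | yes p = empty λ j J≤j j<n → star-low {suc j} {suc i} (inj₂ (linear (k + k) (≤-trans p J≤j) (solve (k ∷ i ∷ j ∷ []))))
                    (inj₂ (s≤s (≤-trans (≤-reflexive (+-comm (suc i) m)) (≤-trans p J≤j))))
    ... | no ¬p = byParity (odd (suc J + suc i)) refl
      where
      i+2<J : suc (suc i) < suc J
      i+2<J = ≤-trans (s≤s (s≤s i<r)) (s≤s m≤J)
      byParity : ∀ b → odd (suc J + suc i) ≡ b → PinnedRight n (diamondSums k (suc i)) (suc J)
      byParity true  o = after J refl (star-alternating {suc J} {suc i} (inj₂ i+2<J) o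
        (linear i m≤J (solve (k ∷ i ∷ J ∷ [])))
        (linear 1 (≰⇒> ¬p) (solve (k ∷ i ∷ J ∷ []))))
      byParity false o = before (≤-trans (≰⇒> ¬p) (+-monoʳ-≤ m (m≤n⇒m≤1+n i<r))) (star-alternating {suc (suc J)} {suc i} (inj₂ (m≤n⇒m≤1+n i+2<J)) (cong not o)
        (linear (suc i) m≤J (solve (k ∷ i ∷ J ∷ [])))
        (linear 0 (≰⇒> ¬p) (solve (k ∷ i ∷ J ∷ []))))

-- Assembly

rot-transfer : ∀ {n c d} → (∀ i j → i ≤ n → j < n → rot n d i j ≡ d i j) → ∀ {i j} → i ≤ n → j < n →
  rot n c (n ∸ i) (n ∸ suc j) ≡ d (n ∸ i) (n ∸ suc j) → c i j ≡ d i j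
rot-transfer {n} {c} {d} rot-d {i} {j} i≤n j<n e = begin
  c i j                                    ≡⟨ cong₂ c (sym (m∸[m∸n]≡n i≤n)) (sym column) ⟩
  c (n ∸ (n ∸ i)) (n ∸ suc (n ∸ suc j))    ≡⟨ not-involutive _ ⟨
  not (rot n c (n ∸ i) (n ∸ suc j))        ≡⟨ cong not e ⟩
  rot n d i j                              ≡⟨ rot-d i j i≤n j<n ⟩
  d i j                                    ∎
  where
  open ≡-Reasoning
  column : n ∸ suc (n ∸ suc j) ≡ j
  column = trans (cong (n ∸_) (sym (∸-suc-< j<n))) (m∸[m∸n]≡n (<⇒≤ j<n))

module _ {a u l b k : ℕ} (total : a + (u + u + (l + l)) ≡ b + (k + k + (k + k))) (k≤u : k ≤ u) (k≤l : k ≤ l) where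

  deficit-≤ : a ≤ b
  deficit-≤ = linear 0 (+-mono-≤ (≤-reflexive total) (+-mono-≤ (+-mono-≤ k≤u k≤u) (+-mono-≤ k≤l k≤l)))
    (eq a b u l k)
    where
    eq : ∀ a b u l k → a + 0 + (b + (k + k + (k + k)) + (u + u + (l + l))) ≡ b + (a + (u + u + (l + l)) + (k + k + (k + k)))
    eq a b u l k = solve (a ∷ b ∷ u ∷ l ∷ k ∷ [])

  deficit-≡ : a ≡ b → u ≡ k × l ≡ k
  deficit-≡ refl = ≤-antisym (halve-≤ u≤k) k≤u , ≤-antisym (halve-≤ l≤k) k≤l
    where
    sums : u + u + (l + l) ≡ k + k + (k + k)
    sums = +-cancelˡ-≡ a _ _ total
    u≤k : u + u ≤ suc (k + k)
    u≤k = linear 1 (+-mono-≤ (≤-reflexive sums) (+-mono-≤ k≤l k≤l)) (solve (u ∷ l ∷ k ∷ []))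
    l≤k : l + l ≤ suc (k + k)
    l≤k = linear 1 (+-mono-≤ (≤-reflexive sums) (+-mono-≤ k≤u k≤u)) (solve (u ∷ l ∷ k ∷ []))

-- The bound is twice the square of m = 2k + 1, less 4k: each half contributes a square and loses
-- 2k.
bound-value : ∀ k → bound (4 * k + 2) + (k + k + (k + k)) ≡ suc (k + k) * suc (k + k) + suc (k + k) * suc (k + k)
bound-value k = trans (cong (λ b → b / 2 + (k + k + (k + k))) numerator)
  (trans (cong (_+ (k + k + (k + k))) (m*n/n≡m (8 * (k * k) + 4 * k + 2) 2)) (closed k))
  where
  expand : ∀ k → (4 * k + 2) * (4 * k + 2) + 4 ≡ (8 * (k * k) + 4 * k + 2) * 2 + 2 * (4 * k + 2)
  expand k = solve (k ∷ [])
  numerator : (4 * k + 2) * (4 * k + 2) + 4 ∸ 2 * (4 * k + 2) ≡ (8 * (k * k) + 4 * k + 2) * 2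
  numerator = trans (cong (_∸ 2 * (4 * k + 2)) (expand k)) (m+n∸n≡m ((8 * (k * k) + 4 * k + 2) * 2) (2 * (4 * k + 2)))
  closed : ∀ k → 8 * (k * k) + 4 * k + 2 + (k + k + (k + k)) ≡ suc (k + k) * suc (k + k) + suc (k + k) * suc (k + k)
  closed k = solve (k ∷ [])

module Main (k : ℕ) where

  open Star k
  open Extremal k

  private
    m n N : ℕ
    m = suc (k + k)
    n = m + m
    N = 4 * k + 2

    d : ℕ → ℕ → Bool
    d = diamondSums k

    N≡n : N ≡ n
    N≡n = eq k
      where
      eq : ∀ k → 4 * k + 2 ≡ suc (k + k) + suc (k + k)
      eq k = solve (k ∷ [])

    toℕ<n′ : ∀ (i : Fin N) → toℕ i < n
    toℕ<n′ i = subst (toℕ i <_) N≡n (toℕ<n i)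

    m≤n : m ≤ n
    m≤n = m≤m+n m m

    n∸m≡m : n ∸ m ≡ m
    n∸m≡m = m+n∸m≡n m m

  hollowedDiamond≡entry : ∀ i j → hollowedDiamond k i j ≡ entry (suc (toℕ i)) (suc (toℕ j))
  hollowedDiamond≡entry i j = cong (λ m → if hollowed k (suc (toℕ i)) (suc (toℕ j)) then pos 0 else diamondEntry m (suc (toℕ i)) (suc (toℕ j))) (eq k)
    where
    eq : ∀ k → 2 * k + 1 ≡ suc (k + k)
    eq k = solve (k ∷ [])

  symmetric : IsSymmetric (hollowedDiamond k)
  symmetric i j = trans (hollowedDiamond≡entry i j) (trans (entry-sym (suc (toℕ i)) (suc (toℕ j))) (sym (hollowedDiamond≡entry j i)))

  zeroDiagonal : ZeroDiagonal (hollowedDiamond k)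
  zeroDiagonal i = trans (hollowedDiamond≡entry i i) (entry-diag (toℕ i))

  rows : ∀ i → Prefix (hollowedDiamond k i) false (λ j → d j (toℕ i))
  rows i = prefix (star-start {suc (toℕ i)})
    (trans (cong (star k (suc (toℕ i))) N≡n) (star-end (s≤s z≤n) (toℕ<n′ i)))
    (λ j → trans (hollowedDiamond≡entry i j) (entry-step (s≤s z≤n) (toℕ<n′ i)))

  hollowedDiamond-symASM0 : IsSymASM0 (hollowedDiamond k)
  hollowedDiamond-symASM0 = rows⇒symASM0 symmetric zeroDiagonal d rows

  d-path : Path n d
  d-path = subst (λ n → Path n d) N≡n (rows⇒path symmetric zeroDiagonal d rows)

  d-tight : loss m n d ≡ k
  d-tight = ≤-antisym loss-diamondSums (Budget.half≤loss d-path refl)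

  d-tight-below : loss m n (rot n d) ≡ k
  d-tight-below = trans (∑-cong m λ i i<m → ∑-cong n λ j j<n → cong₂ (λ a b → ι (a ∧ b))
    (rot-diamondSums i j (<⇒≤ (≤-trans i<m m≤n)) j<n) (rot-diamondSums (suc i) j (≤-trans i<m m≤n) j<n)) d-tight

  nnz-total : ∀ {M : Matrix N} c → Path n c →
    (∀ i j → M i j ≡ difference (c (toℕ i) (toℕ j)) (c (suc (toℕ i)) (toℕ j))) →
    nnz M + (loss m n c + loss m n c + (loss m n (rot n c) + loss m n (rot n c))) ≡ bound N + (k + k + (k + k))
  nnz-total c P entries = trans (cong (_+ _) (trans (nnz≡changes c entries) (cong (λ n → changes n c) N≡n)))
    (trans (total-changes {m} P) (sym (bound-value k)))

  module _ {c} (P : Path n c) (tight : loss m n c ≡ k) (tight-below : loss m n (rot n c) ≡ k) where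

    -- The left half of the middle row is the right half for the rotated configuration, which is
    -- tight as well, and `d` is invariant under rotation.
    middle : ∀ j → j < n → c m j ≡ d m j
    middle j j<n with m ≤? j
    ... | yes m≤j = subst (λ j → c m j ≡ d m j) (m+[n∸m]≡n m≤j)
      (middle-right P d-path refl tight d-tight (j ∸ m) (+-cancelˡ-< m _ _ (subst (_< n) (sym (m+[n∸m]≡n m≤j)) j<n)))
    ... | no  m≰j = rot-transfer {c = c} rot-diamondSums m≤n j<n (subst₂ (λ a b → rot n c a b ≡ d a b) (sym n∸m≡m)
      (sym (+-∸-assoc m (≰⇒> m≰j)))
      (middle-right (rot-path P) d-path refl tight-below d-tight (m ∸ suc j) (∸-suc-bound (≰⇒> m≰j))))

    middle-rot : ∀ j → j < n → rot n c m j ≡ d m j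
    middle-rot j j<n = trans (cong not (trans (cong (λ a → c a (n ∸ suc j)) n∸m≡m)
      (trans (middle (n ∸ suc j) (∸-suc-bound j<n)) (cong (λ a → d a (n ∸ suc j)) (sym n∸m≡m)))))
      (rot-diamondSums m j m≤n j<n)

    unique : ∀ i j → i ≤ n → j < n → c i j ≡ d i j
    unique i j i≤n j<n with i ≤? m
    ... | yes i≤m = rows-agree P d-path refl tight d-tight shape middle m i i≤m (m≤m+n m i) j j<n
    ... | no  i≰m = rot-transfer {c = c} rot-diamondSums i≤n j<n
      (rows-agree (rot-path P) d-path refl tight-below d-tight shape middle-rot m (n ∸ i)
        (≤-trans (∸-monoʳ-≤ n (<⇒≤ (≰⇒> i≰m))) (≤-reflexive n∸m≡m)) (m≤m+n m _) (n ∸ suc j) (∸-suc-bound j<n))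

  module _ {M : Matrix N} (isASM : IsSymASM0 M) where
    open IsSymASM0 isASM using (asm; diag) renaming (sym to M-sym)

    private
      c : ℕ → ℕ → Bool
      c = proj₁ (rowSums asm)

      P : Path n c
      P = subst (λ n → Path n c) N≡n (rows⇒path M-sym diag c (proj₂ (rowSums asm)))

      entries : ∀ i j → M i j ≡ difference (c (toℕ i) (toℕ j)) (c (suc (toℕ i)) (toℕ j))
      entries = rows⇒entries M-sym c (proj₂ (rowSums asm))

      k≤loss : k ≤ loss m n c
      k≤loss = Budget.half≤loss P refl

      k≤loss-below : k ≤ loss m n (rot n c)
      k≤loss-below = Budget.half≤loss (rot-path P) refl

    nnz≤bound : nnz M ≤ bound N
    nnz≤bound = deficit-≤ (nnz-total c P entries) k≤loss k≤loss-below

    nnz≡bound⇒hollowedDiamond : nnz M ≡ bound N → ∀ i j → M i j ≡ hollowedDiamond k i j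
    nnz≡bound⇒hollowedDiamond e i j = trans (entries i j) (trans
      (cong₂ difference (agree (toℕ i) (<⇒≤ (toℕ<n′ i))) (agree (suc (toℕ i)) (toℕ<n′ i)))
      (sym (rows⇒entries symmetric d rows i j)))
      where
      tights : loss m n c ≡ k × loss m n (rot n c) ≡ k
      tights = deficit-≡ (nnz-total c P entries) k≤loss k≤loss-below e
      agree : ∀ i → i ≤ n → c i (toℕ j) ≡ d i (toℕ j)
      agree i i≤n = unique P (proj₁ tights) (proj₂ tights) i (toℕ j) i≤n (toℕ<n′ j)

  hollowedDiamond⇒nnz≡bound : ∀ {M : Matrix N} → (∀ i j → M i j ≡ hollowedDiamond k i j) → nnz M ≡ bound N
  hollowedDiamond⇒nnz≡bound {M} e = +-cancelʳ-≡ (k + k + (k + k)) _ _ (trans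
    (cong₂ (λ u l → nnz M + (u + u + (l + l))) (sym d-tight) (sym d-tight-below))
    (nnz-total d d-path λ i j → trans (e i j) (rows⇒entries symmetric d rows i j)))

theorem5p2 : (k : ℕ) →
    ((M : Matrix (4 * k + 2)) → IsSymASM0 M → nnz M ≤ bound (4 * k + 2))
    × IsSymASM0 (hollowedDiamond k)
    × ((M : Matrix (4 * k + 2)) → IsSymASM0 M →
    (nnz M ≡ bound (4 * k + 2)) ⇔ (∀ i j → M i j ≡ hollowedDiamond k i j))
theorem5p2 k = (λ M → nnz≤bound) , hollowedDiamond-symASM0 ,
  λ M isASM → mk⇔ (nnz≡bound⇒hollowedDiamond isASM) hollowedDiamond⇒nnz≡bound
  where open Main k
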